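{- Let $q\ge8$ be even. The $\mathrm{Un}\Gamma$-lines (lines meeting the twisted cubic $\mathcal{C}$ in exactly one point and contained in no osculating plane) form one orbit under $G_q$, namely $\{\ell\varphi:\varphi\in G_q\}$ where $\ell$ is the line through $P_0=P(0,0,0,1)$ and $P(1,0,1,0)$. The subgroup of $G_q$ fixing any $\mathrm{Un}\Gamma$-line is trivial.
   Context: $\mathrm{PG}(3,q)$ has points $P(x_0,x_1,x_2,x_3)$; $\boldsymbol{\pi}(c_0,c_1,c_2,c_3)$ is the plane $c_0x_0+c_1x_1+c_2x_2+c_3x_3=0$. The twisted cubic is $\mathcal{C}=\{P(t^3,t^2,t,1):t\in\mathbb{F}_q\}\cup\{P(1,0,0,0)\}$; the osculating planes are $\boldsymbol{\pi}(1,-3t,3t^2,-t^3)$, $t\in\mathbb{F}_q$, and $\boldsymbol{\pi}(0,0,0,1)$. $G_q$ is the group of projectivities of $\mathrm{PG}(3,q)$ mapping $\mathcal{C}$ to itself. -}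

module Defs where

open import Algebra.Bundles using (CommutativeRing)
open import Data.Fin.Base using (Fin; zero; suc)
open import Data.Fin.Patterns using (0F; 1F; 2F; 3F)
open import Data.Maybe.Base using (Maybe; just; nothing)
open import Data.Nat.Base using (ℕ)
open import Data.Product.Base using (∃-syntax; _×_; _,_)
open import Data.Vec.Functional using (Vector; []; _∷_)
open import Function.Base using (_∘_)
open import Function.Bundles using (Inverse; _⇔_)
open import Level using (_⊔_) renaming (suc to lsuc)
open import Relation.Binary.PropositionalEquality.Core using (_≡_)
open import Relation.Binary.PropositionalEquality.Properties as ≡ using ()
open import Relation.Nullary.Negation.Core using (¬_)
import Algebra.Properties.Semiring.Exp as Exp
import Algebra.Properties.Semiring.Mult as Mult
import Algebra.Properties.Semiring.Sum as Sum
import Relation.Binary.Reasoning.Setoid as SetoidReasoning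

record FiniteField c ℓ (q : ℕ) : Set (lsuc (c ⊔ ℓ)) where
  field
    commutativeRing : CommutativeRing c ℓ
  open CommutativeRing commutativeRing public
  field
    1≉0         : ¬ (1# ≈ 0#)
    inverse     : ∀ x → ¬ (x ≈ 0#) → ∃[ y ] (x * y ≈ 1#)
    enumeration : Inverse setoid (≡.setoid (Fin q))

module PG3 {c ℓ q} (F : FiniteField c ℓ q) where

  open FiniteField F hiding (zero)
  open Exp semiring using (_^_)
  open Mult semiring using () renaming (_×_ to _·_)
  open Sum semiring using (sum; sum-cong-≋; sum-replicate-zero; ∑-comm; *-distribˡ-sum; *-distribʳ-sum)
  open SetoidReasoning setoid

  Vec4 : Set c
  Vec4 = Vector Carrier 4

  Matrix4 : Set c
  Matrix4 = Fin 4 → Fin 4 → Carrier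

  Nonzero : Vec4 → Set ℓ
  Nonzero v = ¬ (∀ i → v i ≈ 0#)

  -- Points (and below planes, lines and projectivities) are given by
  -- representatives; the accompanying relation is equality in PG(3,q).
  record Point : Set (c ⊔ ℓ) where
    constructor P
    field
      coord   : Vec4
      nonzero : Nonzero coord
  open Point public

  infix 4 _∼_ _∈ᴸ_ _∈ᴾ_ _⊆ᴾ_ _≈ᴸ_ _≈ᴳ_

  _∼_ : Point → Point → Set (c ⊔ ℓ)
  X ∼ Y = ∃[ k ] (¬ (k ≈ 0#) × (∀ i → coord X i ≈ k * coord Y i))

  record Plane : Set (c ⊔ ℓ) where
    constructor π
    field
      coeff   : Vec4
      nonzero : Nonzero coeff

  _∈ᴾ_ : Point → Plane → Set ℓ
  X ∈ᴾ p = sum (λ i → Plane.coeff p i * coord X i) ≈ 0#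

  record Line : Set (c ⊔ ℓ) where
    constructor join
    field
      A B      : Point
      distinct : ¬ (A ∼ B)

  _∈ᴸ_ : Point → Line → Set (c ⊔ ℓ)
  X ∈ᴸ m = ∃[ a ] ∃[ b ] (∀ i → coord X i ≈ a * coord (Line.A m) i + b * coord (Line.B m) i)

  _≈ᴸ_ : Line → Line → Set (c ⊔ ℓ)
  m ≈ᴸ n = ∀ X → X ∈ᴸ m ⇔ X ∈ᴸ n

  _⊆ᴾ_ : Line → Plane → Set (c ⊔ ℓ)
  m ⊆ᴾ p = ∀ X → X ∈ᴸ m → X ∈ᴾ p

  infixl 7 _·ᴹ_ _*ᴹ_

  _·ᴹ_ : Vec4 → Matrix4 → Vec4
  (x ·ᴹ M) j = sum (λ i → x i * M i j)

  _*ᴹ_ : Matrix4 → Matrix4 → Matrix4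
  (M *ᴹ N) i = M i ·ᴹ N

  δ : ∀ {n} → Fin n → Fin n → Carrier
  δ zero    zero    = 1#
  δ zero    (suc _) = 0#
  δ (suc _) zero    = 0#
  δ (suc i) (suc j) = δ i j

  record Projectivity : Set (c ⊔ ℓ) where
    field
      mat inv  : Matrix4
      inverseʳ : ∀ i j → (mat *ᴹ inv) i j ≈ δ i j
      inverseˡ : ∀ i j → (inv *ᴹ mat) i j ≈ δ i j
  open Projectivity public using (mat)

  _≈ᴳ_ : Projectivity → Projectivity → Set (c ⊔ ℓ)
  φ ≈ᴳ ψ = ∃[ k ] (¬ (k ≈ 0#) × (∀ i j → mat φ i j ≈ k * mat ψ i j))

  sum-zero : ∀ {n} (v : Vector Carrier n) → (∀ i → v i ≈ 0#) → sum v ≈ 0#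
  sum-zero {n} v v≈0 = trans (sum-cong-≋ v≈0) (sum-replicate-zero n)

  sum-δ : ∀ {n} (x : Vector Carrier n) j → sum (λ i → x i * δ i j) ≈ x j
  sum-δ x zero = begin
    x zero * 1# + sum (λ i → x (suc i) * 0#)  ≈⟨ +-cong (*-identityʳ _) (sum-zero (λ i → x (suc i) * 0#) λ i → zeroʳ (x (suc i))) ⟩
    x zero + 0#                               ≈⟨ +-identityʳ _ ⟩
    x zero                                    ∎
  sum-δ x (suc j) = begin
    x zero * 0# + sum (λ i → x (suc i) * δ i j)  ≈⟨ +-cong (zeroʳ _) (sum-δ (x ∘ suc) j) ⟩
    0# + x (suc j)                               ≈⟨ +-identityˡ _ ⟩
    x (suc j)                                    ∎

  ·ᴹ-cong : ∀ {x y} M → (∀ i → x i ≈ y i) → ∀ j → (x ·ᴹ M) j ≈ (y ·ᴹ M) j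
  ·ᴹ-cong M x≈y j = sum-cong-≋ λ i → *-congʳ {M i j} (x≈y i)

  ·ᴹ-scale : ∀ k x M j → ((λ i → k * x i) ·ᴹ M) j ≈ k * (x ·ᴹ M) j
  ·ᴹ-scale k x M j = sym (trans (*-distribˡ-sum k (λ i → x i * M i j))
                                (sum-cong-≋ λ i → sym (*-assoc k (x i) (M i j))))

  ·ᴹ-assoc : ∀ x M N k → ((x ·ᴹ M) ·ᴹ N) k ≈ (x ·ᴹ (M *ᴹ N)) k
  ·ᴹ-assoc x M N k = begin
    sum (λ j → sum (λ i → x i * M i j) * N j k)    ≈⟨ sum-cong-≋ (λ j → *-distribʳ-sum (N j k) (λ i → x i * M i j)) ⟩
    sum (λ j → sum (λ i → x i * M i j * N j k))    ≈⟨ ∑-comm (λ j i → x i * M i j * N j k) ⟩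
    sum (λ i → sum (λ j → x i * M i j * N j k))    ≈⟨ sum-cong-≋ (λ i → sum-cong-≋ λ j → *-assoc (x i) (M i j) (N j k)) ⟩
    sum (λ i → sum (λ j → x i * (M i j * N j k)))  ≈⟨ sum-cong-≋ (λ i → sym (*-distribˡ-sum (x i) (λ j → M i j * N j k))) ⟩
    sum (λ i → x i * sum (λ j → M i j * N j k))    ∎

  module _ (φ : Projectivity) where
    open Projectivity φ using (inv; inverseʳ)

    ·ᴹ-cancel : ∀ x k → ((x ·ᴹ mat φ) ·ᴹ inv) k ≈ x k
    ·ᴹ-cancel x k = begin
      ((x ·ᴹ mat φ) ·ᴹ inv) k    ≈⟨ ·ᴹ-assoc x (mat φ) inv k ⟩
      (x ·ᴹ (mat φ *ᴹ inv)) k    ≈⟨ sum-cong-≋ (λ i → *-congˡ {x i} (inverseʳ i k)) ⟩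
      sum (λ i → x i * δ i k)    ≈⟨ sum-δ x k ⟩
      x k                        ∎

    image-nonzero : ∀ x → Nonzero x → Nonzero (x ·ᴹ mat φ)
    image-nonzero x x≉0 xφ≈0 = x≉0 λ k →
      trans (sym (·ᴹ-cancel x k)) (sum-zero (λ i → (x ·ᴹ mat φ) i * inv i k) λ i → trans (*-congʳ (xφ≈0 i)) (zeroˡ (inv i k)))

  infixl 8 _▹_ _▹ᴸ_

  _▹_ : Point → Projectivity → Point
  X ▹ φ = P (coord X ·ᴹ mat φ) (image-nonzero φ (coord X) (nonzero X))

  ▹-injective : ∀ φ X Y → X ▹ φ ∼ Y ▹ φ → X ∼ Y
  ▹-injective φ X Y (k , k≉0 , eq) = k , k≉0 , λ i → begin
    coord X i                                      ≈⟨ ·ᴹ-cancel φ (coord X) i ⟨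
    ((coord X ·ᴹ mat φ) ·ᴹ inv) i                  ≈⟨ ·ᴹ-cong inv eq i ⟩
    ((λ j → k * (coord Y ·ᴹ mat φ) j) ·ᴹ inv) i    ≈⟨ ·ᴹ-scale k (coord Y ·ᴹ mat φ) inv i ⟩
    k * ((coord Y ·ᴹ mat φ) ·ᴹ inv) i              ≈⟨ *-congˡ (·ᴹ-cancel φ (coord Y) i) ⟩
    k * coord Y i                                  ∎
    where open Projectivity φ using (inv)

  _▹ᴸ_ : Line → Projectivity → Line
  join A B A≁B ▹ᴸ φ = join (A ▹ φ) (B ▹ φ) (A≁B ∘ ▹-injective φ A B)

  identity : Projectivity
  identity = record { mat = δ ; inv = δ ; inverseʳ = λ i → sum-δ (δ i) ; inverseˡ = λ i → sum-δ (δ i) }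

  -- The parameter nothing stands for t = ∞.
  cubicPoint : Maybe Carrier → Point
  cubicPoint (just t) = P (t ^ 3 ∷ t ^ 2 ∷ t ∷ 1# ∷ []) λ z → 1≉0 (z 3F)
  cubicPoint nothing  = P (1# ∷ 0# ∷ 0# ∷ 0# ∷ []) λ z → 1≉0 (z 0F)

  osculatingPlane : Maybe Carrier → Plane
  osculatingPlane (just t) = π (1# ∷ - (3 · t) ∷ 3 · (t ^ 2) ∷ - (t ^ 3) ∷ []) λ z → 1≉0 (z 0F)
  osculatingPlane nothing  = π (0# ∷ 0# ∷ 0# ∷ 1# ∷ []) λ z → 1≉0 (z 3F)

  OnCubic : Point → Set (c ⊔ ℓ)
  OnCubic X = ∃[ t ] (X ∼ cubicPoint t)

  -- X ranges over all points, so the two directions say 𝒞φ ⊆ 𝒞 and 𝒞 ⊆ 𝒞φ.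
  InG : Projectivity → Set (c ⊔ ℓ)
  InG φ = ∀ X → OnCubic X ⇔ OnCubic (X ▹ φ)

  MeetsCubicOnce : Line → Set (c ⊔ ℓ)
  MeetsCubicOnce m =
    ∃[ X ] (OnCubic X × X ∈ᴸ m × (∀ Y → OnCubic Y → Y ∈ᴸ m → Y ∼ X))

  IsUnΓ : Line → Set (c ⊔ ℓ)
  IsUnΓ m = MeetsCubicOnce m × (∀ t → ¬ (m ⊆ᴾ osculatingPlane t))

  P₀ : Point
  P₀ = P (0# ∷ 0# ∷ 0# ∷ 1# ∷ []) λ z → 1≉0 (z 3F)

  P₁₀₁₀ : Point
  P₁₀₁₀ = P (1# ∷ 0# ∷ 1# ∷ 0# ∷ []) λ z → 1≉0 (z 0F)

  ℓ₀ : Line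
  ℓ₀ = join P₀ P₁₀₁₀ λ { (k , _ , eq) → 1≉0 (trans (eq 3F) (zeroʳ k)) }

-- In characteristic 2 the matrix of t ↦ (at + b)/(ct + d) has entries a³, a²c, … without numerical
-- factors, so these projectivities preserve 𝒞 and permute the osculating planes. A line joining P₀ to
-- (x, y, z, w) is an UnΓ-line iff x ≠ 0 and xz ≠ y², and is then the image of ℓ₀ under t ↦ a²t/(act + 1)
-- with (a⁻¹)⁴ = z/x + (y/x)² and c = ay/x.
-- Conversely let φ ∈ G fix P₀, and let A, B, C, D be the coordinates of (t³, t², t, 1)φ. The polynomials
-- AC - B², AD - BC, BD - C² have degree at most 6 < q and vanish on 𝔽_q, so all their coefficients vanish;
-- this forces φ to be of the form t ↦ ηt/(γt + 1). Such a map fixes ℓ₀ only if it is the identity.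
module Submission where

open import Defs
open import Algebra.Bundles using (CommutativeRing; RawRing)
open import Algebra.Core using (Op₂)
open import Algebra.Solver.Ring.AlmostCommutativeRing using (fromCommutativeRing; _-Raw-AlmostCommutative⟶_)
open import Data.Bool.Base using (Bool; true; false; _xor_; _∧_; if_then_else_)
open import Data.Fin as Fin using (Fin; zero; suc; inject≤; punchIn; punchOut; #_)
open import Data.Fin.Patterns using (0F; 1F; 2F; 3F; 4F; 5F; 6F)
open import Data.Fin.Permutation using (permutation)
open import Data.Fin.Properties as Fin using (any?; injective⇒≤; inject≤-injective; punchInᵢ≢i; punchOut-injective)
open import Data.Maybe.Base using (Maybe; just; nothing)
open import Data.Nat.Base as ℕ using (ℕ; suc; _≥_)
open import Data.Nat.Divisibility using (_∣_; divides; ∣m+n∣m⇒∣n; ∣1⇒≡1)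
open import Data.Nat.Properties as ℕ using (+-0-commutativeMonoid; 1+n≰n)
open import Data.Product.Base using (∃-syntax; _×_; _,_; proj₁; proj₂)
open import Data.Vec.Base as Vec using (Vec)
open import Data.Vec.Membership.Propositional.Properties using (∈-lookup)
open import Data.Vec.Relation.Unary.All as All using (All)
open import Data.Vec.Functional using (Vector; []; _∷_)
open import Function.Base using (id; _∘_)
open import Function.Bundles using (Inverse; Equivalence; _⇔_; mk⇔)
open import Function.Definitions using (Injective)
open import Function.Properties.Equivalence using () renaming (sym to ⇔-sym)
open import Function.Construct.Composition using (_⇔-∘_)
open import Level using (_⊔_)
open import Relation.Binary.Definitions using (Decidable; tri<; tri≈; tri>)
open import Relation.Binary.PropositionalEquality as ≡ using (_≡_; _≢_)
open import Relation.Nullary using (¬_; yes; no; does; contradiction)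
open import Relation.Nullary.Decidable using (dec-true; dec-false)
import Algebra.Properties.CommutativeSemigroup as CommutativeSemigroupProperties
import Algebra.Properties.CommutativeMonoid.Sum as CommutativeMonoidSum
import Algebra.Properties.Group as GroupProperties
import Algebra.Properties.Ring as RingProperties
import Algebra.Properties.Semiring.Sum as SemiringSum
import Algebra.Solver.Ring as RingSolver
import Relation.Binary.Reasoning.Setoid as SetoidReasoning

-- Membership in `InG` only says that the point set 𝒞 is preserved. It does not show that such a map
-- comes from a fractional linear map, nor that it carries osculating planes to osculating planes,
-- so `IsUnΓ` is not visibly invariant under `InG`. Instead of determining all of `InG`, the proof
-- relies on the explicit maps `cube g`: for them the behaviour of osculating planes is a polynomial
-- identity, and they already move every point of 𝒞 to `P₀`. An arbitrary `φ` is therefore followed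
-- by a `cube g` that brings the image of `P₀` back to `P₀`, and only the stabilizer of `P₀` has to
-- be computed from vanishing coefficients. Within that stabilizer, both claims reduce to where the
-- single point (1, 0, 1, 0) goes.

-- Involutions on finite sets and the pigeonhole principle.

module _ where
  open CommutativeMonoidSum +-0-commutativeMonoid

  private
    before : ∀ {n} → Fin n → Fin n → ℕ
    before i j = if does (i Fin.<? j) then 1 else 0

    before-irrefl : ∀ {n} (i : Fin n) → before i i ≡ 0
    before-irrefl i rewrite dec-false (i Fin.<? i) (ℕ.<-irrefl ≡.refl) = ≡.refl

    before-total : ∀ {n} {i j : Fin n} → i ≢ j → before i j ℕ.+ before j i ≡ 1
    before-total {i = i} {j} i≢j with Fin.<-cmp i j
    ... | tri< i<j _ j≮i rewrite dec-true (i Fin.<? j) i<j | dec-false (j Fin.<? i) j≮i = ≡.refl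
    ... | tri≈ _ i≡j _ = contradiction i≡j i≢j
    ... | tri> i≮j _ j<i rewrite dec-false (i Fin.<? j) i≮j | dec-true (j Fin.<? i) j<i = ≡.refl

    sum-ones : ∀ {n} (t : Vector ℕ n) → (∀ i → t i ≡ 1) → sum t ≡ n
    sum-ones {ℕ.zero} t t≡1 = ≡.refl
    sum-ones {suc n} t t≡1 = ≡.cong₂ ℕ._+_ (t≡1 0F) (sum-ones (t ∘ suc) (t≡1 ∘ suc))

  -- S counts the i with i < σ i; every i other than z has exactly one of i, σ i counted by S.
  lone-fixedPoint⇒odd : ∀ {n} (σ : Fin n → Fin n) → (∀ i → σ (σ i) ≡ i) →
                        ∀ z → σ z ≡ z → (∀ i → σ i ≡ i → i ≡ z) → ¬ 2 ∣ n
  lone-fixedPoint⇒odd {suc n} σ σσ z σz≡z lone 2∣1+n =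
    contradiction (∣1⇒≡1 (∣m+n∣m⇒∣n (≡.subst (2 ∣_) (ℕ.+-comm 1 n) 2∣1+n) 2∣n)) λ ()
    where
    open ≡.≡-Reasoning
    S = sum (λ i → before i (σ i))

    pair : Fin (suc n) → ℕ
    pair i = before i (σ i) ℕ.+ before (σ i) i

    -- Reindexing by the involution σ exchanges the two summands of `pair`.
    S≡ : S ≡ sum (λ i → before (σ i) i)
    S≡ = ≡.trans (sum-permute (λ i → before i (σ i)) (permutation σ σ σσ σσ))
                 (sum-cong-≗ λ i → ≡.cong (before (σ i)) (σσ i))

    pair-z : pair z ≡ 0
    pair-z rewrite σz≡z | before-irrefl z = ≡.refl

    pair-others : ∀ j → pair (punchIn z j) ≡ 1
    pair-others j = before-total λ eq → punchInᵢ≢i z j (lone _ (≡.sym eq))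

    S+S≡n : S ℕ.+ S ≡ n
    S+S≡n = begin
      S ℕ.+ S                                 ≡⟨ ≡.cong (S ℕ.+_) S≡ ⟩
      S ℕ.+ sum (λ i → before (σ i) i)        ≡⟨ ∑-distrib-+ (λ i → before i (σ i)) (λ i → before (σ i) i) ⟨
      sum pair                                ≡⟨ sum-remove {i = z} pair ⟩
      pair z ℕ.+ sum (pair ∘ punchIn z)       ≡⟨ ≡.cong₂ ℕ._+_ pair-z (sum-ones _ pair-others) ⟩
      n                                       ∎

    2∣n : 2 ∣ n
    2∣n = divides S (≡.trans (≡.sym S+S≡n) (≡.trans (≡.cong (S ℕ.+_) (≡.sym (ℕ.+-identityʳ S))) (ℕ.*-comm 2 S)))

-- If `y` were missed, `punchOut` would squeeze `f` into an injection of `suc n` elements into `n`.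
injective⇒surjective : ∀ {n} (f : Fin n → Fin n) → Injective _≡_ _≡_ f → ∀ y → ∃[ i ] f i ≡ y
injective⇒surjective {suc n} f f-inj y with any? (λ i → f i Fin.≟ y)
... | yes found   = found
... | no  missing = contradiction
  (injective⇒≤ {f = λ i → punchOut (y≢f i)} λ eq → f-inj (punchOut-injective (y≢f _) (y≢f _) eq))
  1+n≰n
  where
  y≢f : ∀ i → y ≢ f i
  y≢f i y≡fi = missing (i , ≡.sym y≡fi)

-- Formulas over arbitrary operations, shared by field elements and solver expressions.

-- The matrix of (u³, u²v, uv², v³) ↦ (s³, s²t, st², t³) for (s, t) = (au + bv, cu + dv);
-- in characteristic 2 the binomial coefficients are 0 or 1.
binaryCube : ∀ {a} {A : Set a} → Op₂ A → Op₂ A → A → A → A → A → Fin 4 → Fin 4 → A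
binaryCube _+_ _*_ a b c d =
    (a * (a * a) ∷ a * (a * c) ∷ a * (c * c) ∷ c * (c * c) ∷ [])
  ∷ (a * (a * b) ∷ a * (a * d) ∷ b * (c * c) ∷ c * (c * d) ∷ [])
  ∷ (a * (b * b) ∷ b * (b * c) ∷ a * (d * d) ∷ c * (d * d) ∷ [])
  ∷ (b * (b * b) ∷ b * (b * d) ∷ b * (d * d) ∷ d * (d * d) ∷ [])
  ∷ []

-- The coefficients, lowest degree first, of the product of two cubics given highest degree first.
cubicProduct : ∀ {a} {A : Set a} → Op₂ A → Op₂ A → (x y : Fin 4 → A) → Vec A 7
cubicProduct _+_ _*_ x y =
        (x 3F * y 3F)
  Vec.∷ ((x 2F * y 3F) + (x 3F * y 2F))
  Vec.∷ (((x 1F * y 3F) + (x 2F * y 2F)) + (x 3F * y 1F))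
  Vec.∷ ((((x 0F * y 3F) + (x 1F * y 2F)) + (x 2F * y 1F)) + (x 3F * y 0F))
  Vec.∷ (((x 0F * y 2F) + (x 1F * y 1F)) + (x 2F * y 0F))
  Vec.∷ ((x 0F * y 1F) + (x 1F * y 0F))
  Vec.∷ (x 0F * y 0F)
  Vec.∷ Vec.[]

-- Computing in commutative rings of characteristic 2.

TwoVanishes : ∀ {c ℓ} → CommutativeRing c ℓ → Set ℓ
TwoVanishes R = 1# + 1# ≈ 0#
  where open CommutativeRing R

module Char2 {c ℓ} (R : CommutativeRing c ℓ) (1+1≈0 : TwoVanishes R) where
  open CommutativeRing R

  open GroupProperties +-group using (ε⁻¹≈ε; inverseˡ-unique)
  open SetoidReasoning setoid

  private
    bit : Bool → Carrier
    bit false = 0#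
    bit true  = 1#

    𝔽₂ : RawRing _ _
    𝔽₂ = record { Carrier = Bool ; _≈_ = _≡_ ; _+_ = _xor_ ; _*_ = _∧_ ; -_ = id ; 0# = false ; 1# = true }

    bit-homo : 𝔽₂ -Raw-AlmostCommutative⟶ fromCommutativeRing R
    bit-homo = record
      { ⟦_⟧    = bit
      ; +-homo = λ { false y → sym (+-identityˡ (bit y)) ; true false → sym (+-identityʳ 1#) ; true true → sym 1+1≈0 }
      ; *-homo = λ { false y → sym (zeroˡ (bit y)) ; true y → sym (*-identityˡ (bit y)) }
      ; -‿homo = λ { false → sym ε⁻¹≈ε ; true → inverseˡ-unique 1# 1# 1+1≈0 }
      ; 0-homo = refl
      ; 1-homo = refl
      }

    bit≟ : ∀ x y → Maybe (bit x ≈ bit y)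
    bit≟ false false = just refl
    bit≟ true  true  = just refl
    bit≟ _     _     = nothing

  -- With coefficients in 𝔽₂ the solver also knows that x + x = 0 and - x = x.
  open RingSolver 𝔽₂ (fromCommutativeRing R) bit-homo bit≟ public
    using (Polynomial; con; var; _:+_; _:*_; _:^_; :-_; _:=_; solve; prove)

  infixl 6 _⊞_
  infixr 7 _⊡_

  _⊞_ : ∀ {x y} → x ≈ 0# → y ≈ 0# → x + y ≈ 0#
  x≈0 ⊞ y≈0 = trans (+-cong x≈0 y≈0) (+-identityˡ 0#)

  _⊡_ : ∀ s {x} → x ≈ 0# → s * x ≈ 0#
  s ⊡ x≈0 = trans (*-congˡ x≈0) (zeroʳ s)

  ≈⇒+≈0 : ∀ {x y} → x ≈ y → x + y ≈ 0#
  ≈⇒+≈0 {x} {y} x≈y = trans (+-congʳ x≈y) (solve 1 (λ y → y :+ y := con false) refl y)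

  infix 3 _follows-from_

  -- To prove x ≈ y, write x + y as a linear combination of quantities known to vanish.
  _follows-from_ : ∀ {x y z} → x + y ≈ z → z ≈ 0# → x ≈ y
  _follows-from_ {x} {y} {z} x+y≈z z≈0 = begin
    x              ≈⟨ solve 2 (λ x y → x := (x :+ y) :+ y) refl x y ⟩
    (x + y) + y    ≈⟨ +-congʳ (trans x+y≈z z≈0) ⟩
    0# + y         ≈⟨ +-identityˡ y ⟩
    y              ∎

  +≈0⇒≈ : ∀ {x y} → x + y ≈ 0# → x ≈ y
  +≈0⇒≈ = refl follows-from_

-- Finite fields: decidable equality, cancellation, characteristic.

module FieldProperties {c ℓ q} (F : FiniteField c ℓ q) where
  open FiniteField F hiding (zero)
  open Inverse enumeration using (to; from; to-cong; from-cong; strictlyInverseˡ; strictlyInverseʳ)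
  open SetoidReasoning setoid
  open RingProperties ring using (-‿involutive; -0#≈0#)

  to-injective : ∀ {x y} → to x ≡ to y → x ≈ y
  to-injective {x} {y} eq = trans (sym (strictlyInverseʳ x)) (trans (from-cong eq) (strictlyInverseʳ y))

  infix 4 _≟_
  _≟_ : Decidable _≈_
  x ≟ y with to x Fin.≟ to y
  ... | yes eq = yes (to-injective eq)
  ... | no neq = no (neq ∘ to-cong)

  *-cancelˡ : ∀ {k x y} → ¬ k ≈ 0# → k * x ≈ k * y → x ≈ y
  *-cancelˡ {k} {x} {y} k≉0 kx≈ky with inverse k k≉0
  ... | k⁻¹ , kk⁻¹≈1 = trans (sym (undo x)) (trans (*-congˡ kx≈ky) (undo y))
    where
    undo : ∀ z → k⁻¹ * (k * z) ≈ z
    undo z = trans (sym (*-assoc k⁻¹ k z)) (trans (*-congʳ (trans (*-comm k⁻¹ k) kk⁻¹≈1)) (*-identityˡ z))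

  *-integral : ∀ {x y} → ¬ x ≈ 0# → x * y ≈ 0# → y ≈ 0#
  *-integral x≉0 xy≈0 = *-cancelˡ x≉0 (trans xy≈0 (sym (zeroʳ _)))

  *-nonzero : ∀ {x y} → ¬ x ≈ 0# → ¬ y ≈ 0# → ¬ x * y ≈ 0#
  *-nonzero x≉0 y≉0 = y≉0 ∘ *-integral x≉0

  -- Otherwise negation is an involution whose only fixed point is 0.
  even⇒1+1≈0 : 2 ∣ q → TwoVanishes commutativeRing
  even⇒1+1≈0 2∣q with 1# + 1# ≟ 0#
  ... | yes 1+1≈0 = 1+1≈0
  ... | no  1+1≉0 = contradiction 2∣q (lone-fixedPoint⇒odd σ σσ (to 0#) σ0 lone)
    where
    σ : Fin q → Fin q
    σ i = to (- from i)

    σσ : ∀ i → σ (σ i) ≡ i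
    σσ i = ≡.trans (to-cong (trans (-‿cong (strictlyInverseʳ _)) (-‿involutive _))) (strictlyInverseˡ i)

    σ0 : σ (to 0#) ≡ to 0#
    σ0 = to-cong (trans (-‿cong (strictlyInverseʳ 0#)) -0#≈0#)

    lone : ∀ i → σ i ≡ i → i ≡ to 0#
    lone i σi≡i = ≡.trans (≡.sym (strictlyInverseˡ i)) (to-cong (*-integral 1+1≉0 (begin
      (1# + 1#) * x    ≈⟨ distribʳ x 1# 1# ⟩
      1# * x + 1# * x  ≈⟨ +-cong (*-identityˡ x) (*-identityˡ x) ⟩
      x + x            ≈⟨ +-congʳ (trans (from-cong (≡.sym σi≡i)) (strictlyInverseʳ (- x))) ⟩
      - x + x          ≈⟨ -‿inverseˡ x ⟩
      0#               ∎)))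
      where x = from i

-- Square roots and zeros of polynomials in characteristic 2.

module Field2 {c ℓ q} (F : FiniteField c ℓ q) (1+1≈0 : TwoVanishes (FiniteField.commutativeRing F)) where
  open FiniteField F hiding (zero)
  open FieldProperties F public
  open Char2 commutativeRing 1+1≈0 public
  open Inverse enumeration using (to; from; to-cong; strictlyInverseˡ; strictlyInverseʳ)

  square≈0 : ∀ {x} → x * x ≈ 0# → x ≈ 0#
  square≈0 {x} xx≈0 with x ≟ 0#
  ... | yes x≈0 = x≈0
  ... | no  x≉0 = *-integral x≉0 xx≈0

  square-injective : ∀ {x y} → x * x ≈ y * y → x ≈ y
  square-injective {x} {y} xx≈yy = +≈0⇒≈ (square≈0
    (trans (solve 2 (λ x y → (x :+ y) :* (x :+ y) := x :* x :+ y :* y) refl x y) (≈⇒+≈0 xx≈yy)))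

  -- Squaring is injective because it is additive with trivial kernel, and an injective self-map of
  -- a finite set is onto.
  sqrt : ∀ x → ∃[ y ] y * y ≈ x
  sqrt x = let i , eq = injective⇒surjective (λ i → to (from i * from i)) inj (to x) in from i , to-injective eq
    where
    inj : Injective _≡_ _≡_ (λ i → to (from i * from i))
    inj {i} {j} eq = ≡.trans (≡.sym (strictlyInverseˡ i))
      (≡.trans (to-cong (square-injective (to-injective eq))) (strictlyInverseˡ j))

  fourthRoot : ∀ x → ∃[ y ] (y * y) * (y * y) ≈ x
  fourthRoot x =
    let y , yy≈x = sqrt x
        z , zz≈y = sqrt y
    in z , trans (*-cong zz≈y zz≈y) yy≈x

  eval : ∀ {n} → Vec Carrier n → Carrier → Carrier
  eval Vec.[]       t = 0#
  eval (c Vec.∷ cs) t = c + t * eval cs t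

  eval-+ : ∀ {n} (p r : Vec Carrier n) t → eval (Vec.zipWith _+_ p r) t ≈ eval p t + eval r t
  eval-+ Vec.[] Vec.[] t = sym (+-identityˡ 0#)
  eval-+ (c Vec.∷ cs) (e Vec.∷ es) t = trans (+-congˡ (*-congˡ (eval-+ cs es t)))
    (solve 5 (λ c e t x y → (c :+ e) :+ t :* (x :+ y) := (c :+ t :* x) :+ (e :+ t :* y)) refl c e t _ _)

  -- The quotient of p(t) - p(x) by t - x.
  quotient : ∀ {n} → Carrier → Vec Carrier (suc n) → Vec Carrier n
  quotient x (c Vec.∷ Vec.[])         = Vec.[]
  quotient x (c Vec.∷ cs@(_ Vec.∷ _)) = eval cs x Vec.∷ quotient x cs

  quotient-correct : ∀ {n} x (p : Vec Carrier (suc n)) t →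
                     (t + x) * eval (quotient x p) t ≈ eval p t + eval p x
  quotient-correct x (c Vec.∷ Vec.[]) t =
    solve 3 (λ x c t → (t :+ x) :* con false := (c :+ t :* con false) :+ (c :+ x :* con false)) refl x c t
  quotient-correct x (c Vec.∷ cs@(_ Vec.∷ _)) t =
    solve 6 (λ x c t Q T E → (t :+ x) :* (E :+ t :* Q) :+ ((c :+ t :* T) :+ (c :+ x :* E)) := t :* ((t :+ x) :* Q :+ (T :+ E)))
      refl x c t (eval (quotient x cs) t) (eval cs t) (eval cs x)
    follows-from t ⊡ ≈⇒+≈0 (quotient-correct x cs t)

  -- The coefficients of the quotient are the successive Horner values of `p` at `x`; each
  -- coefficient of `p` is one Horner value minus `x` times the next.
  quotient≈0⇒≈0 : ∀ {n} x (p : Vec Carrier (suc n)) → All (_≈ 0#) (quotient x p) → eval p x ≈ 0# → All (_≈ 0#) p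
  quotient≈0⇒≈0 x (c Vec.∷ Vec.[]) _ p≈0 = trans (solve 2 (λ x c → c := c :+ x :* con false) refl x c) p≈0 All.∷ All.[]
  quotient≈0⇒≈0 x (c Vec.∷ cs@(_ Vec.∷ _)) (cs[x]≈0 All.∷ quo≈0) p≈0 =
    (solve 3 (λ x c E → c :+ con false := (c :+ x :* E) :+ x :* E) refl x c (eval cs x)
      follows-from p≈0 ⊞ x ⊡ cs[x]≈0)
    All.∷ quotient≈0⇒≈0 x cs quo≈0 cs[x]≈0

  -- Induction on the number of coefficients: dividing by t - x₀ removes one coefficient and one
  -- zero, and the other zeros survive because they differ from x₀.
  vanishing⇒≈0 : ∀ {n} (p : Vec Carrier n) (x : Fin n → Carrier) → (∀ {i j} → x i ≈ x j → i ≡ j) →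
                 (∀ i → eval p (x i) ≈ 0#) → All (_≈ 0#) p
  vanishing⇒≈0 Vec.[] x x-inj p≈0 = All.[]
  vanishing⇒≈0 p@(_ Vec.∷ _) x x-inj p≈0 = quotient≈0⇒≈0 (x 0F) p
    (vanishing⇒≈0 (quotient (x 0F) p) (x ∘ suc) (Fin.suc-injective ∘ x-inj) λ i →
      *-integral (λ eq → contradiction (x-inj (+≈0⇒≈ eq)) λ ())
        (trans (quotient-correct (x 0F) p (x (suc i))) (p≈0 (suc i) ⊞ p≈0 0F)))
    (p≈0 0F)

  coefficients≈0 : ∀ {n} → n ℕ.≤ q → (p : Vec Carrier n) → (∀ t → eval p t ≈ 0#) → All (_≈ 0#) p
  coefficients≈0 n≤q p p≈0 = vanishing⇒≈0 p (λ i → from (inject≤ i n≤q))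
    (λ {i} {j} eq → inject≤-injective n≤q n≤q i j
      (≡.trans (≡.sym (strictlyInverseˡ _)) (≡.trans (to-cong eq) (strictlyInverseˡ _))))
    (λ i → p≈0 _)

-- Points and lines of PG(3,q) up to change of representatives.

module Geometry {κ ℓ q} (F : FiniteField κ ℓ q) (1+1≈0 : TwoVanishes (FiniteField.commutativeRing F)) where
  open FiniteField F hiding (zero)
  open Field2 F 1+1≈0
  open PG3 F
  open CommutativeSemigroupProperties *-commutativeSemigroup using (x∙yz≈yx∙z)
  open SemiringSum semiring using (sum; sum-cong-≋; ∑-distrib-+)
  open SetoidReasoning setoid

  -- A zero scalar would make the coordinates of `X` vanish, so `k` is nonzero automatically.
  ∼-intro : ∀ X Y k → (∀ i → coord X i ≈ k * coord Y i) → X ∼ Y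
  ∼-intro X Y k eq = k , (λ k≈0 → nonzero X λ i → trans (eq i) (trans (*-congʳ k≈0) (zeroˡ _))) , eq

  ≐⇒∼ : ∀ X Y → (∀ i → coord X i ≈ coord Y i) → X ∼ Y
  ≐⇒∼ X Y eq = ∼-intro X Y 1# λ i → trans (eq i) (sym (*-identityˡ _))

  ∼-refl : ∀ X → X ∼ X
  ∼-refl X = ≐⇒∼ X X λ _ → refl

  ∼-sym : ∀ X Y → X ∼ Y → Y ∼ X
  ∼-sym X Y (k , k≉0 , eq) with inverse k k≉0
  ... | k⁻¹ , kk⁻¹≈1 = ∼-intro Y X k⁻¹ λ i →
    solve 4 (λ k k⁻¹ x y → y :+ k⁻¹ :* x := k⁻¹ :* (x :+ k :* y) :+ y :* (k :* k⁻¹ :+ con true)) refl k k⁻¹ (coord X i) (coord Y i)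
    follows-from k⁻¹ ⊡ ≈⇒+≈0 (eq i) ⊞ coord Y i ⊡ ≈⇒+≈0 kk⁻¹≈1

  ∼-trans : ∀ X Y Z → X ∼ Y → Y ∼ Z → X ∼ Z
  ∼-trans X Y Z (k , _ , X≈kY) (l , _ , Y≈lZ) = ∼-intro X Z (k * l) λ i →
    trans (X≈kY i) (trans (*-congˡ (Y≈lZ i)) (sym (*-assoc k l _)))

  ▹-∼ : ∀ φ X Y → X ∼ Y → X ▹ φ ∼ Y ▹ φ
  ▹-∼ φ X Y (k , _ , eq) = ∼-intro (X ▹ φ) (Y ▹ φ) k λ j →
    trans (·ᴹ-cong (mat φ) eq j) (·ᴹ-scale k (coord Y) (mat φ) j)

  combination-▹ : ∀ a b (x y : Vec4) M j → ((λ i → a * x i + b * y i) ·ᴹ M) j ≈ a * (x ·ᴹ M) j + b * (y ·ᴹ M) j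
  combination-▹ a b x y M j = begin
    sum (λ i → (a * x i + b * y i) * M i j)              ≈⟨ sum-cong-≋ (λ i → distribʳ (M i j) (a * x i) (b * y i)) ⟩
    sum (λ i → a * x i * M i j + b * y i * M i j)        ≈⟨ ∑-distrib-+ (λ i → a * x i * M i j) (λ i → b * y i * M i j) ⟩
    ((λ i → a * x i) ·ᴹ M) j + ((λ i → b * y i) ·ᴹ M) j  ≈⟨ +-cong (·ᴹ-scale a x M j) (·ᴹ-scale b y M j) ⟩
    a * (x ·ᴹ M) j + b * (y ·ᴹ M) j                      ∎

  ∈ᴸ-resp-∼ : ∀ m X Y → X ∼ Y → Y ∈ᴸ m → X ∈ᴸ m
  ∈ᴸ-resp-∼ m X Y (k , _ , X≈kY) (a , b , Y≈) = k * a , k * b , λ i → trans (X≈kY i) (trans (*-congˡ (Y≈ i))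
    (solve 5 (λ k a b x y → k :* (a :* x :+ b :* y) := (k :* a) :* x :+ (k :* b) :* y) refl k a b _ _))

  A∈ : ∀ m → Line.A m ∈ᴸ m
  A∈ m = 1# , 0# , λ i → solve 2 (λ x y → x := con true :* x :+ con false :* y) refl _ _

  B∈ : ∀ m → Line.B m ∈ᴸ m
  B∈ m = 0# , 1# , λ i → solve 2 (λ x y → y := con false :* x :+ con true :* y) refl _ _

  ∈ᴸ-▹ : ∀ m φ X → X ∈ᴸ m → X ▹ φ ∈ᴸ m ▹ᴸ φ
  ∈ᴸ-▹ m φ X (a , b , X≈) = a , b , λ j →
    trans (·ᴹ-cong (mat φ) X≈ j) (combination-▹ a b (coord (Line.A m)) (coord (Line.B m)) (mat φ) j)

  join-⊆ : ∀ m n → Line.A m ∈ᴸ n → Line.B m ∈ᴸ n → ∀ X → X ∈ᴸ m → X ∈ᴸ n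
  join-⊆ m n (a , b , A≈) (a′ , b′ , B≈) X (s , t , X≈) =
    s * a + t * a′ , s * b + t * b′ , λ i → trans (X≈ i) (trans (+-cong (*-congˡ (A≈ i)) (*-congˡ (B≈ i)))
      (solve 8 (λ s t a b a′ b′ x y → s :* (a :* x :+ b :* y) :+ t :* (a′ :* x :+ b′ :* y)
                                      := (s :* a :+ t :* a′) :* x :+ (s :* b :+ t :* b′) :* y) refl s t a b a′ b′ _ _))

  join-≈ᴸ : ∀ m n → Line.A m ∈ᴸ n → Line.B m ∈ᴸ n → Line.A n ∈ᴸ m → Line.B n ∈ᴸ m → m ≈ᴸ n
  join-≈ᴸ m n Am∈n Bm∈n An∈m Bn∈m X = mk⇔ (join-⊆ m n Am∈n Bm∈n X) (join-⊆ n m An∈m Bn∈m X)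

  ≈ᴸ-sym : ∀ {m n} → m ≈ᴸ n → n ≈ᴸ m
  ≈ᴸ-sym m≈n X = ⇔-sym (m≈n X)

  ≈ᴸ-trans : ∀ {m n o} → m ≈ᴸ n → n ≈ᴸ o → m ≈ᴸ o
  ≈ᴸ-trans m≈n n≈o X = n≈o X ⇔-∘ m≈n X

  join-cong : ∀ m n → Line.A m ∼ Line.A n → Line.B m ∼ Line.B n → m ≈ᴸ n
  join-cong m n A∼ B∼ = join-≈ᴸ m n
    (∈ᴸ-resp-∼ n (Line.A m) (Line.A n) A∼ (A∈ n)) (∈ᴸ-resp-∼ n (Line.B m) (Line.B n) B∼ (B∈ n))
    (∈ᴸ-resp-∼ m (Line.A n) (Line.A m) (∼-sym (Line.A m) (Line.A n) A∼) (A∈ m))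
    (∈ᴸ-resp-∼ m (Line.B n) (Line.B m) (∼-sym (Line.B m) (Line.B n) B∼) (B∈ m))

  ≈ᴸ-▹ : ∀ m n φ → m ≈ᴸ n → m ▹ᴸ φ ≈ᴸ n ▹ᴸ φ
  ≈ᴸ-▹ m n φ m≈n = join-≈ᴸ (m ▹ᴸ φ) (n ▹ᴸ φ)
    (∈ᴸ-▹ n φ (Line.A m) (Equivalence.to (m≈n (Line.A m)) (A∈ m)))
    (∈ᴸ-▹ n φ (Line.B m) (Equivalence.to (m≈n (Line.B m)) (B∈ m)))
    (∈ᴸ-▹ m φ (Line.A n) (Equivalence.from (m≈n (Line.A n)) (A∈ n)))
    (∈ᴸ-▹ m φ (Line.B n) (Equivalence.from (m≈n (Line.B n)) (B∈ n)))

  swap : Line → Line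
  swap (join A B A≁B) = join B A (A≁B ∘ ∼-sym B A)

  swap-≈ᴸ : ∀ m → m ≈ᴸ swap m
  swap-≈ᴸ m = join-≈ᴸ m (swap m) (B∈ (swap m)) (A∈ (swap m)) (B∈ m) (A∈ m)

  replace-B : ∀ m X u v (distinct : ¬ (Line.A m ∼ X)) → ¬ v ≈ 0# →
              (∀ i → coord X i ≈ u * coord (Line.A m) i + v * coord (Line.B m) i) → m ≈ᴸ join (Line.A m) X distinct
  replace-B m X u v A≁X v≉0 X≈ = join-≈ᴸ m n (A∈ n) B∈n (A∈ m) (u , v , X≈)
    where
    n = join (Line.A m) X A≁X
    B∈n : Line.B m ∈ᴸ n
    B∈n with inverse v v≉0
    ... | v⁻¹ , vv⁻¹≈1 = v⁻¹ * u , v⁻¹ , λ i →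
      solve 6 (λ u v v⁻¹ x a b → b :+ ((v⁻¹ :* u) :* a :+ v⁻¹ :* x)
                                  := v⁻¹ :* (x :+ (u :* a :+ v :* b)) :+ b :* (v :* v⁻¹ :+ con true))
        refl u v v⁻¹ (coord X i) (coord (Line.A m) i) (coord (Line.B m) i)
      follows-from v⁻¹ ⊡ ≈⇒+≈0 (X≈ i) ⊞ coord (Line.B m) i ⊡ ≈⇒+≈0 vv⁻¹≈1

  A≁combination : ∀ m X u v → ¬ v ≈ 0# →
                  (∀ i → coord X i ≈ u * coord (Line.A m) i + v * coord (Line.B m) i) → ¬ (Line.A m ∼ X)
  A≁combination m X u v v≉0 X≈ (k , k≉0 , A≈kX) with inverse (k * v) (*-nonzero k≉0 v≉0)
  -- A = kX and X = uA + vB give kvB = (1 + ku)A, so B would be proportional to A.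
  ... | w , kvw≈1 = Line.distinct m (∼-sym (Line.B m) (Line.A m) (∼-intro (Line.B m) (Line.A m) (w * (1# + k * u)) λ i →
    solve 7 (λ k u v w a b x → b :+ (w :* (con true :+ k :* u)) :* a
                               := w :* (a :+ k :* x) :+ (w :* k) :* (x :+ (u :* a :+ v :* b)) :+ b :* ((k :* v) :* w :+ con true))
      refl k u v w (coord (Line.A m) i) (coord (Line.B m) i) (coord X i)
    follows-from w ⊡ ≈⇒+≈0 (A≈kX i) ⊞ (w * k) ⊡ ≈⇒+≈0 (X≈ i) ⊞ coord (Line.B m) i ⊡ ≈⇒+≈0 kvw≈1))

  private
    through′ : ∀ m X a b → ¬ b ≈ 0# → (∀ i → coord X i ≈ a * coord (Line.A m) i + b * coord (Line.B m) i) →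
               ∃[ Y ] ∃[ X≁Y ] m ≈ᴸ join X Y X≁Y
    through′ m X a b b≉0 X≈ = Line.A m , Line.distinct (swap n) ,
      ≈ᴸ-trans {m} {n} {swap n} (replace-B m X a b A≁X b≉0 X≈) (swap-≈ᴸ n)
      where
      A≁X = A≁combination m X a b b≉0 X≈
      n   = join (Line.A m) X A≁X

  -- A line comes with two arbitrary spanning points. This re-bases it at a prescribed one, so that
  -- lines through `P₀` can be taken in the form `join P₀ B`. `X` replaces a generator whose
  -- coefficient is nonzero.
  through : ∀ m X → X ∈ᴸ m → ∃[ Y ] ∃[ X≁Y ] m ≈ᴸ join X Y X≁Y
  through m X (a , b , X≈) with b ≟ 0#
  ... | no b≉0 = through′ m X a b b≉0 X≈
  ... | yes b≈0 =
    let Y , X≁Y , eq = through′ (swap m) X b a a≉0 (λ i → trans (X≈ i) (+-comm _ _))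
    in Y , X≁Y , ≈ᴸ-trans {m} {swap m} {join X Y X≁Y} (swap-≈ᴸ m) eq
    where
    a≉0 : ¬ a ≈ 0#
    a≉0 a≈0 = nonzero X λ i → trans (X≈ i) (trans (*-congʳ a≈0) (zeroˡ _) ⊞ trans (*-congʳ b≈0) (zeroˡ _))

  -- Composition of projectivities and the group of the cubic.

  invert : Projectivity → Projectivity
  invert φ = record { mat = inv ; inv = mat φ ; inverseʳ = inverseˡ ; inverseˡ = inverseʳ }
    where open Projectivity φ using (inv; inverseʳ; inverseˡ)

  product-inverse : ∀ φ ψ i j → ((mat φ *ᴹ mat ψ) *ᴹ (mat (invert ψ) *ᴹ mat (invert φ))) i j ≈ δ i j
  product-inverse φ ψ i j = begin
    ((mat φ i ·ᴹ mat ψ) ·ᴹ (mat (invert ψ) *ᴹ mat (invert φ))) j  ≈⟨ ·ᴹ-assoc (mat φ i ·ᴹ mat ψ) (mat (invert ψ)) (mat (invert φ)) j ⟨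
    (((mat φ i ·ᴹ mat ψ) ·ᴹ mat (invert ψ)) ·ᴹ mat (invert φ)) j  ≈⟨ ·ᴹ-cong (mat (invert φ)) (·ᴹ-cancel ψ (mat φ i)) j ⟩
    (mat φ *ᴹ mat (invert φ)) i j                                 ≈⟨ Projectivity.inverseʳ φ i j ⟩
    δ i j                                                         ∎

  infixl 7 _⨾_
  _⨾_ : Projectivity → Projectivity → Projectivity
  φ ⨾ ψ = record
    { mat      = mat φ *ᴹ mat ψ
    ; inv      = mat (invert ψ) *ᴹ mat (invert φ)
    ; inverseʳ = product-inverse φ ψ
    ; inverseˡ = product-inverse (invert ψ) (invert φ)
    }

  ▹-⨾ : ∀ φ ψ X → X ▹ φ ▹ ψ ∼ X ▹ (φ ⨾ ψ)
  ▹-⨾ φ ψ X = ≐⇒∼ (X ▹ φ ▹ ψ) (X ▹ (φ ⨾ ψ)) (·ᴹ-assoc (coord X) (mat φ) (mat ψ))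

  ▹-invert : ∀ φ X → X ▹ φ ▹ invert φ ∼ X
  ▹-invert φ X = ≐⇒∼ (X ▹ φ ▹ invert φ) X (·ᴹ-cancel φ (coord X))

  ▹ᴸ-⨾ : ∀ φ ψ m → m ▹ᴸ φ ▹ᴸ ψ ≈ᴸ m ▹ᴸ (φ ⨾ ψ)
  ▹ᴸ-⨾ φ ψ m = join-cong (m ▹ᴸ φ ▹ᴸ ψ) (m ▹ᴸ (φ ⨾ ψ)) (▹-⨾ φ ψ (Line.A m)) (▹-⨾ φ ψ (Line.B m))

  ▹ᴸ-invert : ∀ φ m → m ▹ᴸ φ ▹ᴸ invert φ ≈ᴸ m
  ▹ᴸ-invert φ m = join-cong (m ▹ᴸ φ ▹ᴸ invert φ) m (▹-invert φ (Line.A m)) (▹-invert φ (Line.B m))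

  OnCubic-resp-∼ : ∀ X Y → X ∼ Y → OnCubic Y → OnCubic X
  OnCubic-resp-∼ X Y X∼Y (t , Y∼) = t , ∼-trans X Y (cubicPoint t) X∼Y Y∼

  OnCubic-resp-⇔ : ∀ X Y → X ∼ Y → OnCubic X ⇔ OnCubic Y
  OnCubic-resp-⇔ X Y X∼Y = mk⇔ (OnCubic-resp-∼ Y X (∼-sym X Y X∼Y)) (OnCubic-resp-∼ X Y X∼Y)

  InG-⨾ : ∀ φ ψ → InG φ → InG ψ → InG (φ ⨾ ψ)
  InG-⨾ φ ψ φ∈G ψ∈G X = OnCubic-resp-⇔ (X ▹ φ ▹ ψ) (X ▹ (φ ⨾ ψ)) (▹-⨾ φ ψ X) ⇔-∘ (ψ∈G (X ▹ φ) ⇔-∘ φ∈G X)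

  InG-intro : ∀ φ → (∀ X → OnCubic X → OnCubic (X ▹ φ)) → (∀ X → OnCubic X → OnCubic (X ▹ invert φ)) → InG φ
  InG-intro φ fwd bwd X = mk⇔ (fwd X) λ Xφ∈C →
    OnCubic-resp-∼ X (X ▹ φ ▹ invert φ) (∼-sym (X ▹ φ ▹ invert φ) X (▹-invert φ X)) (bwd (X ▹ φ) Xφ∈C)

  InG-invert : ∀ φ → InG φ → InG (invert φ)
  InG-invert φ φ∈G = InG-intro (invert φ)
    (λ X X∈C → Equivalence.from (φ∈G (X ▹ invert φ)) (OnCubic-resp-∼ (X ▹ invert φ ▹ φ) X (▹-invert (invert φ) X) X∈C))
    (λ X → Equivalence.to (φ∈G X))

  -- The action of 2×2 matrices of determinant 1 on the cubic.

  -- Every field element is a square, so an invertible 2×2 matrix can be scaled to determinant 1.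
  -- The inverse is then the adjugate, which has no signs in characteristic 2.
  record SL₂ : Set (κ ⊔ ℓ) where
    field
      a b c d : Carrier
      det≈1   : a * d + b * c ≈ 1#

  adjugate : SL₂ → SL₂
  adjugate g = record { a = d ; b = b ; c = c ; d = a ; det≈1 = trans (+-congʳ (*-comm d a)) det≈1 }
    where open SL₂ g

  cubeMatrix : Carrier → Carrier → Carrier → Carrier → Matrix4
  cubeMatrix = binaryCube _+_ _*_

  private
    module _ {n : ℕ} where
      sumᴱ : (Fin 4 → Polynomial n) → Polynomial n
      sumᴱ f = f 0F :+ (f 1F :+ (f 2F :+ (f 3F :+ con false)))

      cubeᴱ : (a b c d : Polynomial n) → Fin 4 → Fin 4 → Polynomial n
      cubeᴱ = binaryCube _:+_ _:*_

      δᴱ : Fin 4 → Fin 4 → Polynomial n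
      δᴱ i j = con (does (i Fin.≟ j))

      rowᴱ : (x₀ x₁ x₂ x₃ : Polynomial n) → Fin 4 → Polynomial n
      rowᴱ x₀ x₁ x₂ x₃ = x₀ ∷ x₁ ∷ x₂ ∷ x₃ ∷ []

      P₀ᴱ· : (Fin 4 → Polynomial n) → Polynomial n
      P₀ᴱ· x = sumᴱ λ i → rowᴱ (con false) (con false) (con false) (con true) i :* x i

      veroneseᴱ dualVeroneseᴱ : (u v : Polynomial n) → Fin 4 → Polynomial n
      veroneseᴱ u v = rowᴱ (u :* (u :* u)) (u :* (u :* v)) (u :* (v :* v)) (v :* (v :* v))
      dualVeroneseᴱ u v = rowᴱ (v :* (v :* v)) (v :* (v :* u)) (v :* (u :* u)) (u :* (u :* u))

    -- `cubeMatrix` is multiplicative, and a 2×2 matrix times its adjugate is the scalar `det`,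
    -- whose cube matrix is the scalar det³.
    cube-adjugate : ∀ a b c d → a * d + b * c ≈ 1# → ∀ i j → (cubeMatrix a b c d *ᴹ cubeMatrix d b c a) i j ≈ δ i j
    cube-adjugate a b c d det≈1 = entry
      where
      det = a * d + b * c

      det³≈1 : det * (det * det) ≈ 1#
      det³≈1 = trans (*-cong det≈1 (trans (*-cong det≈1 det≈1) (*-identityˡ 1#))) (*-identityˡ 1#)

      identityᴱ : Fin 4 → Fin 4 → (a b c d : Polynomial 4) → _
      identityᴱ i j a b c d =
        sumᴱ (λ k → cubeᴱ a b c d i k :* cubeᴱ d b c a k j) := (let D = a :* d :+ b :* c in D :* (D :* D)) :* δᴱ i j

      scaled : ∀ {x} → x ≈ det * (det * det) * 1# → x ≈ 1#
      scaled eq = trans eq (trans (*-identityʳ _) det³≈1)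

      vanishes : ∀ {x} → x ≈ det * (det * det) * 0# → x ≈ 0#
      vanishes eq = trans eq (zeroʳ _)

      entry : ∀ i j → (cubeMatrix a b c d *ᴹ cubeMatrix d b c a) i j ≈ δ i j
      entry 0F 0F = scaled (solve 4 (identityᴱ 0F 0F) refl a b c d)
      entry 0F 1F = vanishes (solve 4 (identityᴱ 0F 1F) refl a b c d)
      entry 0F 2F = vanishes (solve 4 (identityᴱ 0F 2F) refl a b c d)
      entry 0F 3F = vanishes (solve 4 (identityᴱ 0F 3F) refl a b c d)
      entry 1F 0F = vanishes (solve 4 (identityᴱ 1F 0F) refl a b c d)
      entry 1F 1F = scaled (solve 4 (identityᴱ 1F 1F) refl a b c d)
      entry 1F 2F = vanishes (solve 4 (identityᴱ 1F 2F) refl a b c d)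
      entry 1F 3F = vanishes (solve 4 (identityᴱ 1F 3F) refl a b c d)
      entry 2F 0F = vanishes (solve 4 (identityᴱ 2F 0F) refl a b c d)
      entry 2F 1F = vanishes (solve 4 (identityᴱ 2F 1F) refl a b c d)
      entry 2F 2F = scaled (solve 4 (identityᴱ 2F 2F) refl a b c d)
      entry 2F 3F = vanishes (solve 4 (identityᴱ 2F 3F) refl a b c d)
      entry 3F 0F = vanishes (solve 4 (identityᴱ 3F 0F) refl a b c d)
      entry 3F 1F = vanishes (solve 4 (identityᴱ 3F 1F) refl a b c d)
      entry 3F 2F = vanishes (solve 4 (identityᴱ 3F 2F) refl a b c d)
      entry 3F 3F = scaled (solve 4 (identityᴱ 3F 3F) refl a b c d)

  cube : SL₂ → Projectivity
  cube g = record
    { mat      = cubeMatrix a b c d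
    ; inv      = cubeMatrix d b c a
    ; inverseʳ = cube-adjugate a b c d det≈1
    ; inverseˡ = cube-adjugate d b c a (SL₂.det≈1 (adjugate g))
    }
    where open SL₂ g

  -- (u : v) is the homogeneous parameter, t = u / v.
  veronese : Carrier → Carrier → Vec4
  veronese u v = u * (u * u) ∷ u * (u * v) ∷ u * (v * v) ∷ v * (v * v) ∷ []

  -- In characteristic 2 the factors -3, 3 and -1 all equal 1, so the osculating plane at (u : v)
  -- has the coordinates of the point at (u : v) in reverse order.
  dualVeronese : Carrier → Carrier → Vec4
  dualVeronese u v = v * (v * v) ∷ v * (v * u) ∷ v * (u * u) ∷ u * (u * u) ∷ []

  veronese-cube : ∀ k u v a b c d j →
    ((λ i → k * veronese u v i) ·ᴹ cubeMatrix a b c d) j ≈ k * veronese (a * u + b * v) (c * u + d * v) j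
  veronese-cube k u v a b c d = λ
    { 0F → solve 7 (identityᴱ 0F) refl k u v a b c d
    ; 1F → solve 7 (identityᴱ 1F) refl k u v a b c d
    ; 2F → solve 7 (identityᴱ 2F) refl k u v a b c d
    ; 3F → solve 7 (identityᴱ 3F) refl k u v a b c d }
    where
    identityᴱ : Fin 4 → (k u v a b c d : Polynomial 7) → _
    identityᴱ j k u v a b c d =
      sumᴱ (λ i → (k :* veroneseᴱ u v i) :* cubeᴱ a b c d i j) := k :* veroneseᴱ (a :* u :+ b :* v) (c :* u :+ d :* v) j

  -- Pulling a plane back along a map moves its parameter by the inverse map, here written as the
  -- adjugate.
  dualVeronese-cube : ∀ u v (x : Vec4) a b c d →
    sum (λ j → dualVeronese u v j * (x ·ᴹ cubeMatrix a b c d) j) ≈ sum (λ j → dualVeronese (d * u + b * v) (c * u + a * v) j * x j)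
  dualVeronese-cube u v x a b c d =
    solve 10 (λ u v x₀ x₁ x₂ x₃ a b c d →
      sumᴱ (λ j → dualVeroneseᴱ u v j :* sumᴱ (λ i → rowᴱ x₀ x₁ x₂ x₃ i :* cubeᴱ a b c d i j))
        := sumᴱ (λ j → dualVeroneseᴱ (d :* u :+ b :* v) (c :* u :+ a :* v) j :* rowᴱ x₀ x₁ x₂ x₃ j))
      refl u v (x 0F) (x 1F) (x 2F) (x 3F) a b c d

  cubicPoint-veronese : ∀ s → ∃[ u ] ∃[ v ] (∀ i → coord (cubicPoint s) i ≈ veronese u v i)
  cubicPoint-veronese (just t) = t , 1# , λ
    { 0F → solve 1 (λ t → t :^ 3 := veroneseᴱ t (con true) 0F) refl t
    ; 1F → solve 1 (λ t → t :^ 2 := veroneseᴱ t (con true) 1F) refl t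
    ; 2F → solve 1 (λ t → t := veroneseᴱ t (con true) 2F) refl t
    ; 3F → solve 1 (λ t → con true := veroneseᴱ t (con true) 3F) refl t }
  cubicPoint-veronese nothing = 1# , 0# , λ
    { 0F → solve 0 (con true := veroneseᴱ (con true) (con false) 0F) refl
    ; 1F → solve 0 (con false := veroneseᴱ (con true) (con false) 1F) refl
    ; 2F → solve 0 (con false := veroneseᴱ (con true) (con false) 2F) refl
    ; 3F → solve 0 (con false := veroneseᴱ (con true) (con false) 3F) refl }

  OnCubic-veronese : ∀ X → OnCubic X → ∃[ k ] ∃[ u ] ∃[ v ] (∀ i → coord X i ≈ k * veronese u v i)
  OnCubic-veronese X (s , k , _ , X≈) =
    let u , v , eq = cubicPoint-veronese s in k , u , v , λ i → trans (X≈ i) (*-congˡ (eq i))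

  veronese-OnCubic : ∀ X k u v → (∀ i → coord X i ≈ k * veronese u v i) → OnCubic X
  veronese-OnCubic X k u v X≈ with v ≟ 0#
  ... | yes v≈0 = nothing , ∼-intro X (cubicPoint nothing) (k * (u * (u * u))) λ
    { 0F → trans (X≈ 0F) (sym (*-identityʳ _))
    ; 1F → trans (X≈ 1F) (drop (u ⊡ u ⊡ v≈0))
    ; 2F → trans (X≈ 2F) (drop (u ⊡ v ⊡ v≈0))
    ; 3F → trans (X≈ 3F) (drop (v ⊡ v ⊡ v≈0)) }
    where
    drop : ∀ {x} → x ≈ 0# → k * x ≈ k * (u * (u * u)) * 0#
    drop x≈0 = trans (k ⊡ x≈0) (sym (zeroʳ _))
  ... | no v≉0 with inverse v v≉0
  ... | w , vw≈1 = just (u * w) , ∼-intro X (cubicPoint (just (u * w))) (k * (v * (v * v))) λ i → trans (X≈ i) (eq i)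
    where
    vw+1≈0 = ≈⇒+≈0 vw≈1

    eq : ∀ i → k * veronese u v i ≈ k * (v * (v * v)) * coord (cubicPoint (just (u * w))) i
    -- This is 1 + s³ = (1 + s)(1 + s + s²) with s = vw, times ku³.
    eq 0F = solve 4 (λ k u v w → k :* (u :* (u :* u)) :+ k :* (v :* (v :* v)) :* (u :* w) :^ 3
                              := (k :* (u :* (u :* u)) :* (con true :+ v :* w :+ (v :* w) :* (v :* w))) :* (v :* w :+ con true)) refl k u v w
            follows-from _ ⊡ vw+1≈0
    eq 1F = solve 4 (λ k u v w → k :* (u :* (u :* v)) :+ k :* (v :* (v :* v)) :* (u :* w) :^ 2
                              := (k :* (u :* (u :* v)) :* (con true :+ v :* w)) :* (v :* w :+ con true)) refl k u v w
            follows-from _ ⊡ vw+1≈0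
    eq 2F = solve 4 (λ k u v w → k :* (u :* (v :* v)) :+ k :* (v :* (v :* v)) :* (u :* w)
                              := (k :* (u :* (v :* v))) :* (v :* w :+ con true)) refl k u v w
            follows-from _ ⊡ vw+1≈0
    eq 3F = sym (*-identityʳ _)

  cube-OnCubic : ∀ g X → OnCubic X → OnCubic (X ▹ cube g)
  cube-OnCubic g X X∈C with OnCubic-veronese X X∈C
  ... | k , u , v , X≈ = veronese-OnCubic (X ▹ cube g) k (a * u + b * v) (c * u + d * v) λ j →
    trans (·ᴹ-cong (mat (cube g)) X≈ j) (veronese-cube k u v a b c d j)
    where open SL₂ g

  cube∈G : ∀ g → InG (cube g)
  cube∈G g = InG-intro (cube g) (cube-OnCubic g) (cube-OnCubic (adjugate g))

  -- Osculating planes under 2×2 matrices.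

  -- With homogeneous parameters t = ∞ is like any other value, so the action on planes needs no
  -- case distinction.
  Osculates : Carrier → Carrier → Point → Set ℓ
  Osculates u v X = sum (λ i → dualVeronese u v i * coord X i) ≈ 0#

  private
    planeᴱ : ∀ {n} (t x₀ x₁ x₂ x₃ : Polynomial n) → Polynomial n
    planeᴱ t x₀ x₁ x₂ x₃ = sumᴱ λ i → rowᴱ (con true) (:- triple t) (triple (t :^ 2)) (:- (t :^ 3)) i :* rowᴱ x₀ x₁ x₂ x₃ i
      where triple = λ y → y :+ (y :+ (y :+ con false))

    dualᴱ : ∀ {n} (u v x₀ x₁ x₂ x₃ : Polynomial n) → Polynomial n
    dualᴱ u v x₀ x₁ x₂ x₃ = sumᴱ λ i → dualVeroneseᴱ u v i :* rowᴱ x₀ x₁ x₂ x₃ i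

  osculatingPlane⇒Osculates : ∀ s → ∃[ u ] ∃[ v ] (¬ (u ≈ 0# × v ≈ 0#) × ∀ X → X ∈ᴾ osculatingPlane s → Osculates u v X)
  osculatingPlane⇒Osculates (just t) = t , 1# , (λ (_ , 1≈0) → 1≉0 1≈0) , λ X X∈ → trans
    (solve 5 (λ t x₀ x₁ x₂ x₃ → dualᴱ t (con true) x₀ x₁ x₂ x₃ := planeᴱ t x₀ x₁ x₂ x₃)
      refl t (coord X 0F) (coord X 1F) (coord X 2F) (coord X 3F))
    X∈
  osculatingPlane⇒Osculates nothing = 1# , 0# , (λ (1≈0 , _) → 1≉0 1≈0) , λ X X∈ → trans
    (solve 4 (λ x₀ x₁ x₂ x₃ → dualᴱ (con true) (con false) x₀ x₁ x₂ x₃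
                              := P₀ᴱ· (rowᴱ x₀ x₁ x₂ x₃))
      refl (coord X 0F) (coord X 1F) (coord X 2F) (coord X 3F))
    X∈

  Osculates⇒osculatingPlane : ∀ u v → ¬ (u ≈ 0# × v ≈ 0#) → ∃[ s ] ∀ X → Osculates u v X → X ∈ᴾ osculatingPlane s
  Osculates⇒osculatingPlane u v uv≉0 with v ≟ 0#
  ... | yes v≈0 = nothing , λ X X∈ → *-integral (*-nonzero u≉0 (*-nonzero u≉0 u≉0))
    (solve 6 (λ u v x₀ x₁ x₂ x₃ →
       (u :* (u :* u)) :* P₀ᴱ· (rowᴱ x₀ x₁ x₂ x₃) :+ con false
         := dualᴱ u v x₀ x₁ x₂ x₃ :+ (v :* v :* x₀ :+ v :* u :* x₁ :+ u :* u :* x₂) :* v)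
       refl u v (coord X 0F) (coord X 1F) (coord X 2F) (coord X 3F)
     follows-from X∈ ⊞ _ ⊡ v≈0)
    where
    u≉0 : ¬ u ≈ 0#
    u≉0 u≈0 = uv≉0 (u≈0 , v≈0)
  ... | no v≉0 with inverse v v≉0
  ... | w , vw≈1 = just (u * w) , λ X X∈ → *-integral (*-nonzero v≉0 (*-nonzero v≉0 v≉0))
    (solve 7 (λ u v w x₀ x₁ x₂ x₃ →
       (v :* (v :* v)) :* planeᴱ (u :* w) x₀ x₁ x₂ x₃ :+ con false
         := dualᴱ u v x₀ x₁ x₂ x₃
            :+ (v :* v :* u :* x₁ :+ v :* u :* u :* (v :* w :+ con true) :* x₂
                :+ u :* u :* u :* (v :* w :* v :* w :+ v :* w :+ con true) :* x₃) :* (v :* w :+ con true))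
       refl u v w (coord X 0F) (coord X 1F) (coord X 2F) (coord X 3F)
     follows-from X∈ ⊞ _ ⊡ ≈⇒+≈0 vw≈1)

  -- Planes are pulled back, not pushed forward: an osculating plane containing the image of a line
  -- must yield one containing the line itself.
  cube-osculatingPlane : ∀ g s → ∃[ s′ ] ∀ X → X ▹ cube g ∈ᴾ osculatingPlane s → X ∈ᴾ osculatingPlane s′
  cube-osculatingPlane g s =
    let u , v , uv≉0 , ⇒Osc = osculatingPlane⇒Osculates s
        s′ , Osc⇒           = Osculates⇒osculatingPlane (d * u + b * v) (c * u + a * v) (uv≉0 ∘ preimage u v)
    in s′ , λ X Xg∈ → Osc⇒ X (trans (sym (dualVeronese-cube u v (coord X) a b c d)) (⇒Osc (X ▹ cube g) Xg∈))
    where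
    open SL₂ g
    preimage : ∀ u v → (d * u + b * v ≈ 0#) × (c * u + a * v ≈ 0#) → u ≈ 0# × v ≈ 0#
    preimage u v (u′≈0 , v′≈0) =
      (solve 6 (λ a b c d u v → u :+ con false
          := a :* (d :* u :+ b :* v) :+ b :* (c :* u :+ a :* v) :+ u :* ((a :* d :+ b :* c) :+ con true)) refl a b c d u v
        follows-from a ⊡ u′≈0 ⊞ b ⊡ v′≈0 ⊞ u ⊡ ≈⇒+≈0 det≈1) ,
      (solve 6 (λ a b c d u v → v :+ con false
          := c :* (d :* u :+ b :* v) :+ d :* (c :* u :+ a :* v) :+ v :* ((a :* d :+ b :* c) :+ con true)) refl a b c d u v
        follows-from c ⊡ u′≈0 ⊞ d ⊡ v′≈0 ⊞ v ⊡ ≈⇒+≈0 det≈1)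

  -- Invariance of UnΓ-lines, and moving points of the cubic to `P₀`.

  IsUnΓ-resp-≈ᴸ : ∀ m n → m ≈ᴸ n → IsUnΓ m → IsUnΓ n
  IsUnΓ-resp-≈ᴸ m n m≈n ((X , X∈C , X∈m , unique) , m⊈) =
    (X , X∈C , Equivalence.to (m≈n X) X∈m , λ Y Y∈C Y∈n → unique Y Y∈C (Equivalence.from (m≈n Y) Y∈n)) ,
    λ s n⊆ → m⊈ s λ Y Y∈m → n⊆ Y (Equivalence.to (m≈n Y) Y∈m)

  MeetsCubicOnce-▹ : ∀ φ m → InG φ → MeetsCubicOnce m → MeetsCubicOnce (m ▹ᴸ φ)
  MeetsCubicOnce-▹ φ m φ∈G (X , X∈C , X∈m , unique) =
    X ▹ φ , Equivalence.to (φ∈G X) X∈C , ∈ᴸ-▹ m φ X X∈m , λ Y Y∈C Y∈mφ →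
      let Z   = Y ▹ invert φ
          Zφ∼Y = ▹-invert (invert φ) Y
          Z∈C = Equivalence.to (InG-invert φ φ∈G Y) Y∈C
          Z∈m = Equivalence.to (▹ᴸ-invert φ m Z) (∈ᴸ-▹ (m ▹ᴸ φ) (invert φ) Y Y∈mφ)
      in ∼-trans Y (Z ▹ φ) (X ▹ φ) (∼-sym (Z ▹ φ) Y Zφ∼Y) (▹-∼ φ Z X (unique Z Z∈C Z∈m))

  IsUnΓ-cube : ∀ g m → IsUnΓ m → IsUnΓ (m ▹ᴸ cube g)
  IsUnΓ-cube g m (once , m⊈) = MeetsCubicOnce-▹ (cube g) m (cube∈G g) once , λ s mg⊆ →
    let s′ , preimage = cube-osculatingPlane g s
    in m⊈ s′ λ X X∈m → preimage X (mg⊆ (X ▹ cube g) (∈ᴸ-▹ m (cube g) X X∈m))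

  veronese-∼P₀ : ∀ X k u v → u ≈ 0# → (∀ i → coord X i ≈ k * veronese u v i) → X ∼ P₀
  veronese-∼P₀ X k u v u≈0 X≈ = ∼-intro X P₀ (k * (v * (v * v))) λ
    { 0F → solve 4 (λ x k u v → x :+ (k :* (v :* (v :* v))) :* con false := (x :+ k :* veroneseᴱ u v 0F) :+ (k :* u :* u) :* u) refl _ k u v
           follows-from ≈⇒+≈0 (X≈ 0F) ⊞ _ ⊡ u≈0
    ; 1F → solve 4 (λ x k u v → x :+ (k :* (v :* (v :* v))) :* con false := (x :+ k :* veroneseᴱ u v 1F) :+ (k :* u :* v) :* u) refl _ k u v
           follows-from ≈⇒+≈0 (X≈ 1F) ⊞ _ ⊡ u≈0
    ; 2F → solve 4 (λ x k u v → x :+ (k :* (v :* (v :* v))) :* con false := (x :+ k :* veroneseᴱ u v 2F) :+ (k :* v :* v) :* u) refl _ k u v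
           follows-from ≈⇒+≈0 (X≈ 2F) ⊞ _ ⊡ u≈0
    ; 3F → trans (X≈ 3F) (sym (*-identityʳ _)) }

  P₀∈C : OnCubic P₀
  P₀∈C = veronese-OnCubic P₀ 1# 0# 1# λ
    { 0F → solve 0 (con false := con true :* veroneseᴱ (con false) (con true) 0F) refl
    ; 1F → solve 0 (con false := con true :* veroneseᴱ (con false) (con true) 1F) refl
    ; 2F → solve 0 (con false := con true :* veroneseᴱ (con false) (con true) 2F) refl
    ; 3F → solve 0 (con true := con true :* veroneseᴱ (con false) (con true) 3F) refl }

  moveTo-P₀ : ∀ X → OnCubic X → ∃[ g ] X ▹ cube g ∼ P₀
  moveTo-P₀ X (s , k , _ , X≈) =
    let u , v , s≈ = cubicPoint-veronese s
        g , u′≈0   = kill s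
        open SL₂ g
    in g , veronese-∼P₀ (X ▹ cube g) k (a * u + b * v) (c * u + d * v) u′≈0 λ j →
         trans (·ᴹ-cong (mat (cube g)) (λ i → trans (X≈ i) (*-congˡ (s≈ i))) j) (veronese-cube k u v a b c d j)
    where
    kill : ∀ s → ∃[ g ] SL₂.a g * proj₁ (cubicPoint-veronese s) + SL₂.b g * proj₁ (proj₂ (cubicPoint-veronese s)) ≈ 0#
    -- s ↦ s + t takes t to 0, and s ↦ 1/s takes ∞ to 0; the parameter 0 belongs to `P₀`.
    kill (just t) =
      record { a = 1# ; b = t ; c = 0# ; d = 1# ; det≈1 = solve 1 (λ t → con true :* con true :+ t :* con false := con true) refl t } ,
      solve 1 (λ t → con true :* t :+ t :* con true := con false) refl t
    kill nothing =
      record { a = 0# ; b = 1# ; c = 1# ; d = 0# ; det≈1 = solve 0 (con false :* con false :+ con true :* con true := con true) refl } ,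
      solve 0 (con false :* con true :+ con true :* con false := con false) refl

  -- The stabilizer of `P₀` in the group of the cubic.

  -- These are the 2×2 minors of the matrix with rows (x₀, x₁, x₂) and (x₁, x₂, x₃). On 𝒞 the rows
  -- are multiples of (u², uv, v²) by ku and kv.
  OnCubic⇒relations : ∀ X → OnCubic X → let x = coord X in
    (x 0F * x 2F + x 1F * x 1F ≈ 0#) × (x 0F * x 3F + x 1F * x 2F ≈ 0#) × (x 1F * x 3F + x 2F * x 2F ≈ 0#)
  OnCubic⇒relations X X∈C =
    let k , u , v , X≈ = OnCubic-veronese X X∈C
        product = λ i j → *-cong (X≈ i) (X≈ j)
    in trans (+-cong (product 0F 2F) (product 1F 1F)) (solve 3 (λ k u v → relationᴱ 0F 2F 1F 1F k u v := con false) refl k u v) ,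
       trans (+-cong (product 0F 3F) (product 1F 2F)) (solve 3 (λ k u v → relationᴱ 0F 3F 1F 2F k u v := con false) refl k u v) ,
       trans (+-cong (product 1F 3F) (product 2F 2F)) (solve 3 (λ k u v → relationᴱ 1F 3F 2F 2F k u v := con false) refl k u v)
    where
    relationᴱ : (i j i′ j′ : Fin 4) → (k u v : Polynomial 3) → Polynomial 3
    relationᴱ i j i′ j′ k u v =
      (k :* veroneseᴱ u v i) :* (k :* veroneseᴱ u v j) :+ (k :* veroneseᴱ u v i′) :* (k :* veroneseᴱ u v j′)

  cubicValue : Vec4 → Carrier → Carrier
  cubicValue x t = sum (λ i → coord (cubicPoint (just t)) i * x i)

  eval-cubicProduct : ∀ x y t → eval (cubicProduct _+_ _*_ x y) t ≈ cubicValue x t * cubicValue y t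
  eval-cubicProduct x y t =
    solve 9 (λ t x₀ x₁ x₂ x₃ y₀ y₁ y₂ y₃ →
      Vec.foldr′ (λ e r → e :+ t :* r) (con false) (cubicProduct _:+_ _:*_ (rowᴱ x₀ x₁ x₂ x₃) (rowᴱ y₀ y₁ y₂ y₃))
        := value t x₀ x₁ x₂ x₃ :* value t y₀ y₁ y₂ y₃)
      refl t (x 0F) (x 1F) (x 2F) (x 3F) (y 0F) (y 1F) (y 2F) (y 3F)
    where
    value : (t x₀ x₁ x₂ x₃ : Polynomial 9) → Polynomial 9
    value t x₀ x₁ x₂ x₃ = sumᴱ (λ i → rowᴱ (t :^ 3) (t :^ 2) t (con true) i :* rowᴱ x₀ x₁ x₂ x₃ i)

  coefficients : (x y z w : Vec4) → Vec Carrier 7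
  coefficients x y z w = Vec.zipWith _+_ (cubicProduct _+_ _*_ x y) (cubicProduct _+_ _*_ z w)

  -- The only place where the size of `q` enters: a product of two cubics has seven coefficients.
  coefficients-vanish : 7 ℕ.≤ q → ∀ x y z w →
    (∀ t → cubicValue x t * cubicValue y t + cubicValue z t * cubicValue w t ≈ 0#) →
    ∀ k → Vec.lookup (coefficients x y z w) k ≈ 0#
  coefficients-vanish 7≤q x y z w xy+zw≈0 k =
    All.lookup (coefficients≈0 7≤q (coefficients x y z w) λ t → trans
      (eval-+ (cubicProduct _+_ _*_ x y) (cubicProduct _+_ _*_ z w) t)
      (trans (+-cong (eval-cubicProduct x y t) (eval-cubicProduct z w t)) (xy+zw≈0 t)))
    (∈-lookup k (coefficients x y z w))

  -- The columns of M with its last row replaced by (0, 0, 0, e), so that the zeros are literal for the solver.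
  column : Matrix4 → Carrier → Fin 4 → Vec4
  column M e j = M 0F j ∷ M 1F j ∷ M 2F j ∷ (0# ∷ 0# ∷ 0# ∷ e ∷ []) j ∷ []

  private
    -- Columns 0 to 3 hold the coefficients of A, B, C, D; `k` is the power of t.
    Relation : Matrix4 → Carrier → (i j i′ j′ : Fin 4) → Set ℓ
    Relation M e i j i′ j′ =
      ∀ k → Vec.lookup (coefficients (column M e i) (column M e j) (column M e i′) (column M e j′)) k ≈ 0#

    -- Only D has a constant term, namely `e`, so in the low powers of t the one pivot is `e`, and
    -- they determine the entries down to M₀₀ = eη³. Column 0 is then (eη³, 0, 0, 0), and since it
    -- is not zero, η ≠ 0. Now M₀₀ and M₂₂ = eη can serve as pivots for the high powers, which give
    -- the remaining entries.
    solveRelations : ∀ M e → ¬ e ≈ 0# → ¬ (∀ i → column M e 0F i ≈ 0#) →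
      Relation M e 0F 2F 1F 1F → Relation M e 0F 3F 1F 2F → Relation M e 1F 3F 2F 2F →
      ∃[ η ] ∃[ γ ] (¬ η ≈ 0# × ∀ i j → column M e j i ≈ e * cubeMatrix η 0# γ 1# i j)
    solveRelations M e e≉0 column₀≉0 R₁ R₂ R₃ = η , γ , η≉0 , λ
      { 0F → λ { 0F → z₀₀ ; 1F → z₀₁ ; 2F → z₀₂ ; 3F → z₀₃ }
      ; 1F → λ { 0F → z₁₀ ; 1F → z₁₁ ; 2F → z₁₂ ; 3F → z₁₃ }
      ; 2F → λ { 0F → z₂₀ ; 1F → z₂₁ ; 2F → z₂₂ ; 3F → z₂₃ }
      ; 3F → λ
        { 0F → solve 1 (λ e → con false := e :* cubeᴱ (con false) (con false) (con false) (con true) 3F 0F) refl e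
        ; 1F → solve 1 (λ e → con false := e :* cubeᴱ (con false) (con false) (con false) (con true) 3F 1F) refl e
        ; 2F → solve 1 (λ e → con false := e :* cubeᴱ (con false) (con false) (con false) (con true) 3F 2F) refl e
        ; 3F → solve 1 (λ e → e := e :* cubeᴱ (con false) (con false) (con false) (con true) 3F 3F) refl e } }
      where
      e⁻¹ = proj₁ (inverse e e≉0)
      -- The cube matrix of t ↦ ηt/(γt + 1) has third row (0, 0, η, γ).
      η = e⁻¹ * M 2F 2F
      γ = e⁻¹ * M 2F 3F

      -- For the solver `η` and `γ` are independent variables; their definition from `M` enters only
      -- through `z₂₂` and `z₂₃`.
      ρ : Vec Carrier 15
      ρ = M 0F 0F Vec.∷ M 0F 1F Vec.∷ M 0F 2F Vec.∷ M 0F 3F Vec.∷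
          M 1F 0F Vec.∷ M 1F 1F Vec.∷ M 1F 2F Vec.∷ M 1F 3F Vec.∷
          M 2F 0F Vec.∷ M 2F 1F Vec.∷ M 2F 2F Vec.∷ M 2F 3F Vec.∷
          e Vec.∷ η Vec.∷ γ Vec.∷ Vec.[]

      eᴱ ηᴱ γᴱ : Polynomial 15
      eᴱ = var (# 12)
      ηᴱ = var (# 13)
      γᴱ = var (# 14)

      -- Z i j is the difference of the (i, j) entry of M and its claimed value. The entries are determined
      -- one after the other, each by the coefficient of some tᵏ in AC = B² (R₁), AD = BC (R₂) or BD = C² (R₃).
      mᴱ target Z : Fin 4 → Fin 4 → Polynomial 15
      mᴱ = rowᴱ (var (# 0)) (var (# 1)) (var (# 2)) (var (# 3))
         ∷ rowᴱ (var (# 4)) (var (# 5)) (var (# 6)) (var (# 7))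
         ∷ rowᴱ (var (# 8)) (var (# 9)) (var (# 10)) (var (# 11))
         ∷ rowᴱ (con false) (con false) (con false) eᴱ
         ∷ []
      target i j = eᴱ :* cubeᴱ ηᴱ (con false) γᴱ (con true) i j
      Z i j = mᴱ i j :+ target i j

      R : (i j i′ j′ : Fin 4) → Fin 7 → Polynomial 15
      R i j i′ j′ k = Vec.lookup (Vec.zipWith _:+_ (product i j) (product i′ j′)) k
        where
        product : Fin 4 → Fin 4 → Vec (Polynomial 15) 7
        product i j = cubicProduct _:+_ _:*_ (λ k → mᴱ k i) (λ k → mᴱ k j)

      R₁ᴱ = R 0F 2F 1F 1F
      R₂ᴱ = R 0F 3F 1F 2F
      R₃ᴱ = R 1F 3F 2F 2F

      by : ∀ {s x y z} → ¬ s ≈ 0# → s * (x + y) ≈ z → z ≈ 0# → x ≈ y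
      by s≉0 eq z≈0 = +≈0⇒≈ (*-integral s≉0 (trans eq z≈0))

      over-e : ∀ x → x ≈ e * (e⁻¹ * x * (1# * 1#))
      over-e x = solve 3 (λ e e⁻¹ x → x :+ e :* (e⁻¹ :* x :* (con true :* con true)) := x :* (e :* e⁻¹ :+ con true)) refl e e⁻¹ x
        follows-from x ⊡ ≈⇒+≈0 (proj₂ (inverse e e≉0))

      z₂₂ : M 2F 2F ≈ e * cubeMatrix η 0# γ 1# 2F 2F
      z₂₂ = over-e (M 2F 2F)

      z₂₃ : M 2F 3F ≈ e * cubeMatrix η 0# γ 1# 2F 3F
      z₂₃ = over-e (M 2F 3F)

      z₂₁ : M 2F 1F ≈ e * cubeMatrix η 0# γ 1# 2F 1F
      z₂₁ = by e≉0 (prove ρ (eᴱ :* Z 2F 1F)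
        (R₃ᴱ 1F) refl)
        (R₃ 1F)

      z₂₀ : M 2F 0F ≈ e * cubeMatrix η 0# γ 1# 2F 0F
      z₂₀ = by e≉0 (prove ρ (eᴱ :* Z 2F 0F)
        (R₂ᴱ 1F) refl)
        (R₂ 1F)

      z₁₀ : M 1F 0F ≈ e * cubeMatrix η 0# γ 1# 1F 0F
      z₁₀ = by e≉0 (prove ρ (eᴱ :* Z 1F 0F)
        (R₂ᴱ 2F :+ mᴱ 2F 3F :* Z 2F 0F :+ mᴱ 2F 2F :* Z 2F 1F) refl)
        (R₂ 2F ⊞ _ ⊡ ≈⇒+≈0 z₂₀ ⊞ _ ⊡ ≈⇒+≈0 z₂₁)

      z₁₁ : M 1F 1F ≈ e * cubeMatrix η 0# γ 1# 1F 1F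
      -- The relation gives eM₁₁ = M₂₂², and M₂₂² + (eη)² is the square of `Z 2F 2F`.
      z₁₁ = by e≉0 (prove ρ (eᴱ :* Z 1F 1F)
        (R₃ᴱ 2F :+ mᴱ 2F 3F :* Z 2F 1F :+ (Z 2F 2F) :* Z 2F 2F) refl)
        (R₃ 2F ⊞ _ ⊡ ≈⇒+≈0 z₂₁ ⊞ _ ⊡ ≈⇒+≈0 z₂₂)

      z₀₀ : M 0F 0F ≈ e * cubeMatrix η 0# γ 1# 0F 0F
      z₀₀ = by e≉0 (prove ρ (eᴱ :* Z 0F 0F)
        (R₂ᴱ 3F :+ mᴱ 2F 3F :* Z 1F 0F :+ mᴱ 1F 3F :* Z 2F 0F :+ mᴱ 1F 2F :* Z 2F 1F :+ mᴱ 2F 2F :* Z 1F 1F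
          :+ (eᴱ :* (ηᴱ :* ηᴱ)) :* Z 2F 2F) refl)
        (R₂ 3F ⊞ _ ⊡ ≈⇒+≈0 z₁₀ ⊞ _ ⊡ ≈⇒+≈0 z₂₀ ⊞ _ ⊡ ≈⇒+≈0 z₂₁ ⊞ _ ⊡ ≈⇒+≈0 z₁₁ ⊞ _ ⊡ ≈⇒+≈0 z₂₂)

      η≉0 : ¬ η ≈ 0#
      η≉0 η≈0 = column₀≉0 λ
        { 0F → trans z₀₀ (e ⊡ η ⊡ η ⊡ η≈0)
        ; 1F → trans z₁₀ (e ⊡ η ⊡ zeroʳ η)
        ; 2F → trans z₂₀ (e ⊡ η ⊡ zeroʳ 0#)
        ; 3F → refl }

      M₀₀≉0 : ¬ M 0F 0F ≈ 0#
      M₀₀≉0 M₀₀≈0 = *-nonzero e≉0 (*-nonzero η≉0 (*-nonzero η≉0 η≉0)) (trans (sym z₀₀) M₀₀≈0)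

      M₂₂≉0 : ¬ M 2F 2F ≈ 0#
      M₂₂≉0 M₂₂≈0 = *-nonzero e≉0 (*-nonzero η≉0 (*-nonzero 1≉0 1≉0)) (trans (sym z₂₂) M₂₂≈0)

      z₁₂ : M 1F 2F ≈ e * cubeMatrix η 0# γ 1# 1F 2F
      z₁₂ = by M₀₀≉0 (prove ρ (mᴱ 0F 0F :* Z 1F 2F)
        (R₁ᴱ 5F :+ mᴱ 0F 2F :* Z 1F 0F) refl)
        (R₁ 5F ⊞ _ ⊡ ≈⇒+≈0 z₁₀)

      z₀₁ : M 0F 1F ≈ e * cubeMatrix η 0# γ 1# 0F 1F
      z₀₁ = by M₂₂≉0 (prove ρ (mᴱ 2F 2F :* Z 0F 1F)
        (R₂ᴱ 4F :+ mᴱ 1F 3F :* Z 1F 0F :+ mᴱ 0F 3F :* Z 2F 0F :+ mᴱ 1F 1F :* Z 1F 2F :+ mᴱ 0F 2F :* Z 2F 1F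
          :+ mᴱ 2F 3F :* Z 0F 0F :+ (eᴱ :* (ηᴱ :* ηᴱ :* ηᴱ)) :* Z 2F 3F
          :+ (eᴱ :* (ηᴱ :* ηᴱ :* γᴱ)) :* Z 2F 2F) refl)
        (R₂ 4F ⊞ _ ⊡ ≈⇒+≈0 z₁₀ ⊞ _ ⊡ ≈⇒+≈0 z₂₀ ⊞ _ ⊡ ≈⇒+≈0 z₁₂ ⊞ _ ⊡ ≈⇒+≈0 z₂₁ ⊞ _ ⊡ ≈⇒+≈0 z₀₀ ⊞ _ ⊡ ≈⇒+≈0 z₂₃ ⊞ _ ⊡ ≈⇒+≈0 z₂₂)

      z₀₂ : M 0F 2F ≈ e * cubeMatrix η 0# γ 1# 0F 2F
      z₀₂ = by M₀₀≉0 (prove ρ (mᴱ 0F 0F :* Z 0F 2F)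
        (R₁ᴱ 6F :+ (Z 0F 1F) :* Z 0F 1F :+ (eᴱ :* (ηᴱ :* γᴱ :* γᴱ)) :* Z 0F 0F) refl)
        (R₁ 6F ⊞ _ ⊡ ≈⇒+≈0 z₀₁ ⊞ _ ⊡ ≈⇒+≈0 z₀₀)

      z₁₃ : M 1F 3F ≈ e * cubeMatrix η 0# γ 1# 1F 3F
      z₁₃ = by M₀₀≉0 (prove ρ (mᴱ 0F 0F :* Z 1F 3F)
        (R₂ᴱ 5F :+ mᴱ 0F 3F :* Z 1F 0F :+ mᴱ 0F 1F :* Z 1F 2F :+ mᴱ 0F 2F :* Z 1F 1F
          :+ (eᴱ :* (ηᴱ :* ηᴱ)) :* Z 0F 2F :+ (eᴱ :* (γᴱ :* γᴱ)) :* Z 0F 0F) refl)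
        (R₂ 5F ⊞ _ ⊡ ≈⇒+≈0 z₁₀ ⊞ _ ⊡ ≈⇒+≈0 z₁₂ ⊞ _ ⊡ ≈⇒+≈0 z₁₁ ⊞ _ ⊡ ≈⇒+≈0 z₀₂ ⊞ _ ⊡ ≈⇒+≈0 z₀₀)

      z₀₃ : M 0F 3F ≈ e * cubeMatrix η 0# γ 1# 0F 3F
      z₀₃ = by M₀₀≉0 (prove ρ (mᴱ 0F 0F :* Z 0F 3F)
        (R₂ᴱ 6F :+ mᴱ 0F 2F :* Z 0F 1F :+ (eᴱ :* (ηᴱ :* ηᴱ :* γᴱ)) :* Z 0F 2F :+ (eᴱ :* (γᴱ :* γᴱ :* γᴱ)) :* Z 0F 0F) refl)
        (R₂ 6F ⊞ _ ⊡ ≈⇒+≈0 z₀₁ ⊞ _ ⊡ ≈⇒+≈0 z₀₂ ⊞ _ ⊡ ≈⇒+≈0 z₀₀)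

  stabilizer-P₀ : 7 ℕ.≤ q → ∀ φ → InG φ → P₀ ▹ φ ∼ P₀ →
    ∃[ e ] ∃[ η ] ∃[ γ ] (¬ e ≈ 0# × ¬ η ≈ 0# × ∀ i j → mat φ i j ≈ e * cubeMatrix η 0# γ 1# i j)
  stabilizer-P₀ 7≤q φ φ∈G (e , e≉0 , P₀φ≈eP₀) =
    let η , γ , η≉0 , solution = solveRelations M e e≉0 column₀≉0
          (relation 0F 2F 1F 1F (λ X X∈C → let r₁ , _ , _ = OnCubic⇒relations X X∈C in r₁))
          (relation 0F 3F 1F 2F (λ X X∈C → let _ , r₂ , _ = OnCubic⇒relations X X∈C in r₂))
          (relation 1F 3F 2F 2F (λ X X∈C → let _ , _ , r₃ = OnCubic⇒relations X X∈C in r₃))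
    in e , η , γ , e≉0 , η≉0 , λ i j → trans (sym (column≈ j i)) (solution i j)
    where
    M = mat φ

    lastRow : ∀ j → M 3F j ≈ e * coord P₀ j
    lastRow j = trans
      (solve 4 (λ x₀ x₁ x₂ x₃ → x₃ := P₀ᴱ· (rowᴱ x₀ x₁ x₂ x₃))
        refl (M 0F j) (M 1F j) (M 2F j) (M 3F j))
      (P₀φ≈eP₀ j)

    column≈ : ∀ j i → column M e j i ≈ M i j
    column≈ j 0F = refl
    column≈ j 1F = refl
    column≈ j 2F = refl
    column≈ 0F 3F = sym (trans (lastRow 0F) (zeroʳ e))
    column≈ 1F 3F = sym (trans (lastRow 1F) (zeroʳ e))
    column≈ 2F 3F = sym (trans (lastRow 2F) (zeroʳ e))
    column≈ 3F 3F = sym (trans (lastRow 3F) (*-identityʳ e))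

    column₀≉0 : ¬ (∀ i → column M e 0F i ≈ 0#)
    column₀≉0 column₀≈0 = 1≉0 (trans (sym (inverseˡ 0F 0F))
      (sum-zero (λ i → inv 0F i * M i 0F) λ i → inv 0F i ⊡ trans (sym (column≈ 0F i)) (column₀≈0 i)))
      where open Projectivity φ using (inv; inverseˡ)

    value : ∀ j t → cubicValue (column M e j) t ≈ coord (cubicPoint (just t) ▹ φ) j
    value j t = sum-cong-≋ λ i → *-congˡ {coord (cubicPoint (just t)) i} (column≈ j i)

    relation : ∀ i j i′ j′ →
               (∀ X → OnCubic X → coord X i * coord X j + coord X i′ * coord X j′ ≈ 0#) → Relation M e i j i′ j′
    relation i j i′ j′ onCubic = coefficients-vanish 7≤q (column M e i) (column M e j) (column M e i′) (column M e j′) λ t → trans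
      (+-cong (*-cong (value i t) (value j t)) (*-cong (value i′ t) (value j′ t)))
      (onCubic (cubicPoint (just t) ▹ φ)
        (Equivalence.to (φ∈G (cubicPoint (just t))) (just t , ∼-refl (cubicPoint (just t)))))

  -- UnΓ-lines through `P₀`.

  P₀≁ : ∀ B → ¬ coord B 0F ≈ 0# → ¬ (P₀ ∼ B)
  P₀≁ B x≉0 (k , k≉0 , eq) = *-nonzero k≉0 x≉0 (sym (eq 0F))

  -- The second condition says that the line misses every point P(t³, t², t, 1) with t ≠ 0.
  Transversal : Point → Set ℓ
  Transversal B = ¬ x 0F ≈ 0# × ¬ x 0F * x 2F ≈ x 1F * x 1F
    where x = coord B

  -- The form x₀x₂ + x₁² vanishes on 𝒞 and does not involve x₃, so at uP₀ + vB it equals v²(xz +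
  -- y²); a point of 𝒞 on the line thus has v = 0. The only osculating plane through `P₀` is x₀ = 0,
  -- which misses `B`.
  Transversal⇒IsUnΓ : ∀ B d → Transversal B → IsUnΓ (join P₀ B d)
  Transversal⇒IsUnΓ B d (x≉0 , xz≉yy) = (P₀ , P₀∈C , A∈ m , unique) , not-⊆
    where
    m = join P₀ B d
    x = coord B 0F
    y = coord B 1F
    z = coord B 2F
    w = coord B 3F

    unique : ∀ Y → OnCubic Y → Y ∈ᴸ m → Y ∼ P₀
    unique Y Y∈C (u , v , Y≈) = ∼-intro Y P₀ (u + v * w) λ
      { 0F → trans (Y≈ 0F) (drop x)
      ; 1F → trans (Y≈ 1F) (drop y)
      ; 2F → trans (Y≈ 2F) (drop z)
      ; 3F → trans (Y≈ 3F) (solve 3 (λ u v w → u :* con true :+ v :* w := (u :+ v :* w) :* con true) refl u v w) }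
      where
      v≈0 : v ≈ 0#
      v≈0 = square≈0 (*-integral (λ eq → xz≉yy (+≈0⇒≈ eq)) (trans
        (solve 5 (λ u v x y z → (x :* z :+ y :* y) :* (v :* v)
            := (u :* con false :+ v :* x) :* (u :* con false :+ v :* z) :+ (u :* con false :+ v :* y) :* (u :* con false :+ v :* y))
          refl u v x y z)
        (trans (sym (+-cong (*-cong (Y≈ 0F) (Y≈ 2F)) (*-cong (Y≈ 1F) (Y≈ 1F)))) (proj₁ (OnCubic⇒relations Y Y∈C)))))

      drop : ∀ s → u * 0# + v * s ≈ (u + v * w) * 0#
      drop s = solve 4 (λ u v w s → (u :* con false :+ v :* s) :+ (u :+ v :* w) :* con false := s :* v) refl u v w s
        follows-from s ⊡ v≈0

    not-⊆ : ∀ s → ¬ (m ⊆ᴾ osculatingPlane s)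
    not-⊆ nothing m⊆ = 1≉0 (trans
      (solve 0 (con true := P₀ᴱ· (rowᴱ (con false) (con false) (con false) (con true))) refl)
      (m⊆ P₀ (A∈ m)))
    not-⊆ (just t) m⊆ = x≉0
      (solve 5 (λ t x y z w → x :+ con false := planeᴱ t x y z w :+ (y :+ t :* z :+ t :* t :* w) :* t) refl t x y z w
        follows-from m⊆ B (B∈ m) ⊞ _ ⊡ t≈0)
      where
      ttt≈0 : t * (t * t) ≈ 0#
      ttt≈0 = trans (solve 1 (λ t → t :* (t :* t) := planeᴱ t (con false) (con false) (con false) (con true)) refl t) (m⊆ P₀ (A∈ m))

      t≈0 : t ≈ 0#
      t≈0 with t ≟ 0#
      ... | yes t≈0 = t≈0
      ... | no  t≉0 = square≈0 (*-integral t≉0 ttt≈0)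

  IsUnΓ⇒Transversal : ∀ B d → IsUnΓ (join P₀ B d) → Transversal B
  IsUnΓ⇒Transversal B d ((X , _ , _ , unique) , m⊈) = x≉0 , xz≉yy
    where
    m = join P₀ B d
    x = coord B 0F
    y = coord B 1F
    z = coord B 2F
    w = coord B 3F

    x≉0 : ¬ x ≈ 0#
    -- Otherwise the line lies in x₀ = 0, the osculating plane at t = 0.
    x≉0 x≈0 = m⊈ (just 0#) λ Y (u , v , Y≈) →
      solve 7 (λ u v x y₀ y₁ y₂ y₃ → planeᴱ (con false) y₀ y₁ y₂ y₃ :+ con false
                                := (y₀ :+ (u :* con false :+ v :* x)) :+ v :* x)
        refl u v x (coord Y 0F) (coord Y 1F) (coord Y 2F) (coord Y 3F)
      follows-from ≈⇒+≈0 (Y≈ 0F) ⊞ v ⊡ x≈0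

    xz≉yy : ¬ x * z ≈ y * y
    xz≉yy xz≈yy = P₀≁ Y xxx≉0 (∼-trans P₀ X Y (unique P₀ P₀∈C (A∈ m)) (∼-sym Y X (unique Y
      (veronese-OnCubic Y 1# x y λ i → sym (*-identityˡ _))
      -- When xz = y², x²B is (x³, x²y, xy², x²w), which differs from `veronese x y` only in the
      -- last coordinate; a multiple of `P₀` corrects it.
      (y * (y * y) + x * x * w , x * x , λ
        { 0F → solve 4 (λ x y z w → veroneseᴱ x y 0F := u x y w :* con false :+ x :* x :* x) refl x y z w
        ; 1F → solve 4 (λ x y z w → veroneseᴱ x y 1F := u x y w :* con false :+ x :* x :* y) refl x y z w
        ; 2F → solve 4 (λ x y z w → veroneseᴱ x y 2F :+ (u x y w :* con false :+ x :* x :* z) := x :* (x :* z :+ y :* y)) refl x y z w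
               follows-from x ⊡ ≈⇒+≈0 xz≈yy
        ; 3F → solve 4 (λ x y z w → veroneseᴱ x y 3F := u x y w :* con true :+ x :* x :* w) refl x y z w }))))
      where
      u = λ (x y w : Polynomial 4) → y :* (y :* y) :+ x :* x :* w
      xxx≉0 = *-nonzero x≉0 (*-nonzero x≉0 x≉0)
      Y = P (veronese x y) λ z → xxx≉0 (z 0F)

  -- Under t ↦ ηt/(γt + 1) the point (1, 0, 1, 0) goes to (η³, η²γ, ηγ² + η, γ³ + γ). Matching the
  -- first three coordinates with x, y, z up to a factor requires γ/η = y/x and η⁻² = z/x + (y/x)².
  -- One square root gives η⁻¹; a second one, `f`, gives determinant 1, with η = f⁻². It is nonzero
  -- since x²f⁴ = xz + y².
  transitive : ∀ B d → Transversal B → ∃[ g ] join P₀ B d ≈ᴸ ℓ₀ ▹ᴸ cube g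
  transitive B d (x≉0 , xz≉yy) = g , ≈ᴸ-trans {join P₀ B d} {join P₀ Q P₀≁Q} {ℓ₀ ▹ᴸ cube g}
    (replace-B (join P₀ B d) Q u v P₀≁Q v≉0 Q≈)
    (join-cong (join P₀ Q P₀≁Q) (ℓ₀ ▹ᴸ cube g) (∼-sym (P₀ ▹ cube g) P₀ P₀g∼P₀) (∼-refl Q))
    where
    x = coord B 0F
    y = coord B 1F
    z = coord B 2F
    w = coord B 3F
    x⁻¹ = proj₁ (inverse x x≉0)
    xx⁻¹+1≈0 = ≈⇒+≈0 (proj₂ (inverse x x≉0))

    root = fourthRoot (z * x⁻¹ + (y * x⁻¹) * (y * x⁻¹))
    f    = proj₁ root
    f⁴≈  = proj₂ root

    f≉0 : ¬ f ≈ 0#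
    f≉0 f≈0 = xz≉yy
      (solve 5 (λ x y z f x⁻¹ → x :* z :+ y :* y
          := (x :* x) :* ((f :* f) :* (f :* f) :+ (z :* x⁻¹ :+ (y :* x⁻¹) :* (y :* x⁻¹)))
             :+ (x :* z :+ y :* y :* (x :* x⁻¹ :+ con true)) :* (x :* x⁻¹ :+ con true)
             :+ (x :* x :* f :* f :* f) :* f) refl x y z f x⁻¹
        follows-from (x * x) ⊡ ≈⇒+≈0 f⁴≈ ⊞ _ ⊡ xx⁻¹+1≈0 ⊞ _ ⊡ f≈0)

    f⁻¹ = proj₁ (inverse f f≉0)
    ff⁻¹≈1 = proj₂ (inverse f f≉0)

    f⁻¹≉0 : ¬ f⁻¹ ≈ 0#
    f⁻¹≉0 f⁻¹≈0 = 1≉0 (trans (sym ff⁻¹≈1) (f ⊡ f⁻¹≈0))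

    g : SL₂
    g = record
      { a = f⁻¹ ; b = 0# ; c = f⁻¹ * (y * x⁻¹) ; d = f
      ; det≈1 = solve 3 (λ f f⁻¹ s → (f⁻¹ :* f :+ con false :* (f⁻¹ :* s)) :+ con true := f :* f⁻¹ :+ con true)
                  refl f f⁻¹ (y * x⁻¹)
                follows-from ≈⇒+≈0 ff⁻¹≈1
      }

    P₀g∼P₀ : P₀ ▹ cube g ∼ P₀
    P₀g∼P₀ = ∼-intro (P₀ ▹ cube g) P₀ (f * (f * f)) λ
      { 0F → solve 3 (λ a c d → imageᴱ a c d 0F := (d :* (d :* d)) :* con false) refl (SL₂.a g) (SL₂.c g) f
      ; 1F → solve 3 (λ a c d → imageᴱ a c d 1F := (d :* (d :* d)) :* con false) refl (SL₂.a g) (SL₂.c g) f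
      ; 2F → solve 3 (λ a c d → imageᴱ a c d 2F := (d :* (d :* d)) :* con false) refl (SL₂.a g) (SL₂.c g) f
      ; 3F → solve 3 (λ a c d → imageᴱ a c d 3F := (d :* (d :* d)) :* con true) refl (SL₂.a g) (SL₂.c g) f }
      where
      imageᴱ : (a c d : Polynomial 3) → Fin 4 → Polynomial 3
      imageᴱ a c d j = sumᴱ λ i → rowᴱ (con false) (con false) (con false) (con true) i :* cubeᴱ a (con false) c d i j

    Q = P₁₀₁₀ ▹ cube g
    -- The first coordinate f⁻³ of `Q` fixes `v`; `u` then adjusts the last coordinate, the only one
    -- where `P₀` is nonzero.
    v = f⁻¹ * (f⁻¹ * f⁻¹) * x⁻¹
    u = coord Q 3F + v * w

    v≉0 : ¬ v ≈ 0#
    v≉0 = *-nonzero (*-nonzero f⁻¹≉0 (*-nonzero f⁻¹≉0 f⁻¹≉0)) λ x⁻¹≈0 →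
      1≉0 (trans (sym (proj₂ (inverse x x≉0))) (x ⊡ x⁻¹≈0))

    module _ {n : ℕ} where
      vᴱ : (f⁻¹ x⁻¹ : Polynomial n) → Polynomial n
      vᴱ f⁻¹ x⁻¹ = f⁻¹ :* (f⁻¹ :* f⁻¹) :* x⁻¹

      Qᴱ : (y f f⁻¹ x⁻¹ : Polynomial n) → Fin 4 → Polynomial n
      Qᴱ y f f⁻¹ x⁻¹ j = sumᴱ λ i →
        rowᴱ (con true) (con false) (con true) (con false) i :* cubeᴱ f⁻¹ (con false) (f⁻¹ :* (y :* x⁻¹)) f i j

    Q≈ : ∀ i → coord Q i ≈ u * coord P₀ i + v * coord B i
    Q≈ 0F = solve 6 (λ x y f f⁻¹ x⁻¹ u → Qᴱ y f f⁻¹ x⁻¹ 0F :+ (u :* con false :+ vᴱ f⁻¹ x⁻¹ :* x)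
                := (f⁻¹ :* f⁻¹ :* f⁻¹) :* (x :* x⁻¹ :+ con true)) refl x y f f⁻¹ x⁻¹ u
            follows-from _ ⊡ xx⁻¹+1≈0
    Q≈ 1F = solve 6 (λ x y f f⁻¹ x⁻¹ u → Qᴱ y f f⁻¹ x⁻¹ 1F := u :* con false :+ vᴱ f⁻¹ x⁻¹ :* y) refl x y f f⁻¹ x⁻¹ u
    Q≈ 2F = solve 7 (λ x y f f⁻¹ x⁻¹ u z → Qᴱ y f f⁻¹ x⁻¹ 2F :+ (u :* con false :+ vᴱ f⁻¹ x⁻¹ :* z)
                := (f⁻¹ :* f⁻¹ :* f⁻¹) :* ((f :* f) :* (f :* f) :+ (z :* x⁻¹ :+ (y :* x⁻¹) :* (y :* x⁻¹)))
                   :+ (f⁻¹ :* f :* f :* (f :* f⁻¹ :+ con true)) :* (f :* f⁻¹ :+ con true)) refl x y f f⁻¹ x⁻¹ u z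
            follows-from _ ⊡ ≈⇒+≈0 f⁴≈ ⊞ _ ⊡ ≈⇒+≈0 ff⁻¹≈1
    Q≈ 3F = solve 2 (λ q s → q := (q :+ s) :* con true :+ s) refl (coord Q 3F) (v * w)

    P₀≁Q : ¬ (P₀ ∼ Q)
    P₀≁Q = A≁combination (join P₀ B d) Q u v v≉0 Q≈

  image-P₁₀₁₀ : ∀ φ e η γ → (∀ i j → mat φ i j ≈ e * cubeMatrix η 0# γ 1# i j) →
    let Q = coord (P₁₀₁₀ ▹ φ) in
    Q 0F ≈ e * (η * (η * η)) × Q 1F ≈ e * (η * (η * γ)) × Q 2F ≈ e * (η * (γ * γ) + η)
  image-P₁₀₁₀ φ e η γ φ≈ =
    trans (image≈ 0F) (solve 3 (λ e η γ → imageᴱ e η γ 0F := e :* (η :* (η :* η))) refl e η γ) ,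
    trans (image≈ 1F) (solve 3 (λ e η γ → imageᴱ e η γ 1F := e :* (η :* (η :* γ))) refl e η γ) ,
    trans (image≈ 2F) (solve 3 (λ e η γ → imageᴱ e η γ 2F := e :* (η :* (γ :* γ) :+ η)) refl e η γ)
    where
    image≈ : ∀ j → coord (P₁₀₁₀ ▹ φ) j ≈ sum (λ i → coord P₁₀₁₀ i * (e * cubeMatrix η 0# γ 1# i j))
    image≈ j = sum-cong-≋ λ i → *-congˡ {coord P₁₀₁₀ i} (φ≈ i j)

    imageᴱ : (e η γ : Polynomial 3) → Fin 4 → Polynomial 3
    imageᴱ e η γ j = sumᴱ λ i → rowᴱ (con true) (con false) (con true) (con false) i :* (e :* cubeᴱ η (con false) γ (con true) i j)

  -- The orbit of `ℓ₀`.

  ℓ₀-IsUnΓ : IsUnΓ ℓ₀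
  ℓ₀-IsUnΓ = Transversal⇒IsUnΓ P₁₀₁₀ (Line.distinct ℓ₀)
    (1≉0 , λ 1*1≈0*0 → 1≉0 (trans (sym (*-identityʳ 1#)) (trans 1*1≈0*0 (zeroʳ 0#))))

  -- The image is examined after a further `cube g`, where it passes through `P₀` and `Transversal`
  -- can be tested; `cube (adjugate g)` carries the conclusion back.
  image-IsUnΓ : 7 ℕ.≤ q → ∀ φ → InG φ → IsUnΓ (ℓ₀ ▹ᴸ φ)
  image-IsUnΓ 7≤q φ φ∈G =
    let g , P₀φg∼P₀ = moveTo-P₀ (P₀ ▹ φ) (Equivalence.to (φ∈G P₀) P₀∈C)
        χ           = φ ⨾ cube g
        P₀χ∼P₀      = ∼-trans (P₀ ▹ χ) (P₀ ▹ φ ▹ cube g) P₀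
                        (∼-sym (P₀ ▹ φ ▹ cube g) (P₀ ▹ χ) (▹-⨾ φ (cube g) P₀)) P₀φg∼P₀
        e , η , γ , e≉0 , η≉0 , χ≈ = stabilizer-P₀ 7≤q χ (InG-⨾ φ (cube g) φ∈G (cube∈G g)) P₀χ∼P₀
        x≈ , y≈ , z≈ = image-P₁₀₁₀ χ e η γ χ≈
        B           = P₁₀₁₀ ▹ χ
        η³≉0        = *-nonzero η≉0 (*-nonzero η≉0 η≉0)
        x≉0         = λ x≈0 → *-nonzero e≉0 η³≉0 (trans (sym x≈) x≈0)
        n           = join P₀ B (P₀≁ B x≉0)
        -- For the image of (1, 0, 1, 0), xz + y² = e²η⁴.
        n-IsUnΓ     = Transversal⇒IsUnΓ B (P₀≁ B x≉0) (x≉0 , λ xz≈yy →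
          *-nonzero (*-nonzero e≉0 e≉0) (*-nonzero η≉0 η³≉0) (trans
            (solve 3 (λ e η γ → (e :* e) :* (η :* (η :* (η :* η)))
                := (e :* (η :* (η :* η))) :* (e :* (η :* (γ :* γ) :+ η))
                   :+ (e :* (η :* (η :* γ))) :* (e :* (η :* (η :* γ)))) refl e η γ)
            (trans (sym (+-cong (*-cong x≈ z≈) (*-cong y≈ y≈))) (≈⇒+≈0 xz≈yy))))
        n≈ : n ≈ᴸ ℓ₀ ▹ᴸ φ ▹ᴸ cube g
        n≈ = join-cong n (ℓ₀ ▹ᴸ φ ▹ᴸ cube g)
               (∼-sym (P₀ ▹ φ ▹ cube g) P₀ P₀φg∼P₀)
               (∼-sym (P₁₀₁₀ ▹ φ ▹ cube g) B (▹-⨾ φ (cube g) P₁₀₁₀))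
    -- `cube (adjugate g)` and `invert (cube g)` have the same matrix by definition, so `▹ᴸ-invert`
    -- applies.
    in IsUnΓ-resp-≈ᴸ (ℓ₀ ▹ᴸ φ ▹ᴸ cube g ▹ᴸ cube (adjugate g)) (ℓ₀ ▹ᴸ φ) (▹ᴸ-invert (cube g) (ℓ₀ ▹ᴸ φ))
         (IsUnΓ-cube (adjugate g) (ℓ₀ ▹ᴸ φ ▹ᴸ cube g) (IsUnΓ-resp-≈ᴸ n (ℓ₀ ▹ᴸ φ ▹ᴸ cube g) n≈ n-IsUnΓ))

  -- A map `cube g` takes the point of the line on 𝒞 to `P₀`, where `transitive` applies; its
  -- inverse is appended at the end.
  IsUnΓ⇒image : ∀ m → IsUnΓ m → ∃[ φ ] (InG φ × m ≈ᴸ ℓ₀ ▹ᴸ φ)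
  IsUnΓ⇒image m m-IsUnΓ@((X , X∈C , X∈m , _) , _) =
    let g , Xg∼P₀ = moveTo-P₀ X X∈C
        m′        = m ▹ᴸ cube g
        P₀∈m′     = ∈ᴸ-resp-∼ m′ P₀ (X ▹ cube g) (∼-sym (X ▹ cube g) P₀ Xg∼P₀) (∈ᴸ-▹ m (cube g) X X∈m)
        B , d , m′≈ = through m′ P₀ P₀∈m′
        h , n≈      = transitive B d (IsUnΓ⇒Transversal B d (IsUnΓ-resp-≈ᴸ m′ (join P₀ B d) m′≈ (IsUnΓ-cube g m m-IsUnΓ)))
        g⁻¹         = invert (cube g)
        ℓ′          = ℓ₀ ▹ᴸ cube h
    in cube h ⨾ g⁻¹ , InG-⨾ (cube h) g⁻¹ (cube∈G h) (InG-invert (cube g) (cube∈G g)) ,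
       ≈ᴸ-trans {m} {m′ ▹ᴸ g⁻¹} {ℓ₀ ▹ᴸ (cube h ⨾ g⁻¹)} (≈ᴸ-sym {m′ ▹ᴸ g⁻¹} {m} (▹ᴸ-invert (cube g) m))
         (≈ᴸ-trans {m′ ▹ᴸ g⁻¹} {ℓ′ ▹ᴸ g⁻¹} {ℓ₀ ▹ᴸ (cube h ⨾ g⁻¹)}
           (≈ᴸ-▹ m′ ℓ′ g⁻¹ (≈ᴸ-trans {m′} {join P₀ B d} {ℓ′} m′≈ n≈))
           (▹ᴸ-⨾ (cube h) g⁻¹ ℓ₀))

  -- Triviality of the stabilizers.

  cubeMatrix-identity : ∀ {η γ} → η ≈ 1# → γ ≈ 0# → ∀ i j → cubeMatrix η 0# γ 1# i j ≈ δ i j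
  cubeMatrix-identity η≈1 γ≈0 = λ
    { 0F → λ
      { 0F → trans (*-cong η≈1 (*-cong η≈1 η≈1)) (solve 0 (con true :* (con true :* con true) := con true) refl)
      ; 1F → trans (*-cong η≈1 (*-cong η≈1 γ≈0)) (solve 0 (con true :* (con true :* con false) := con false) refl)
      ; 2F → trans (*-cong η≈1 (*-cong γ≈0 γ≈0)) (solve 0 (con true :* (con false :* con false) := con false) refl)
      ; 3F → trans (*-cong γ≈0 (*-cong γ≈0 γ≈0)) (solve 0 (con false :* (con false :* con false) := con false) refl) }
    ; 1F → λ
      { 0F → trans (*-cong η≈1 (*-cong η≈1 refl)) (solve 0 (con true :* (con true :* con false) := con false) refl)
      ; 1F → trans (*-cong η≈1 (*-cong η≈1 refl)) (solve 0 (con true :* (con true :* con true) := con true) refl)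
      ; 2F → trans (*-cong refl (*-cong γ≈0 γ≈0)) (solve 0 (con false :* (con false :* con false) := con false) refl)
      ; 3F → trans (*-cong γ≈0 (*-cong γ≈0 refl)) (solve 0 (con false :* (con false :* con true) := con false) refl) }
    ; 2F → λ
      { 0F → trans (*-cong η≈1 (*-cong refl refl)) (solve 0 (con true :* (con false :* con false) := con false) refl)
      ; 1F → trans (*-cong refl (*-cong refl γ≈0)) (solve 0 (con false :* (con false :* con false) := con false) refl)
      ; 2F → trans (*-cong η≈1 (*-cong refl refl)) (solve 0 (con true :* (con true :* con true) := con true) refl)
      ; 3F → trans (*-cong γ≈0 (*-cong refl refl)) (solve 0 (con false :* (con true :* con true) := con false) refl) }
    ; 3F → λ
      { 0F → trans (*-cong refl (*-cong refl refl)) (solve 0 (con false :* (con false :* con false) := con false) refl)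
      ; 1F → trans (*-cong refl (*-cong refl refl)) (solve 0 (con false :* (con false :* con true) := con false) refl)
      ; 2F → trans (*-cong refl (*-cong refl refl)) (solve 0 (con false :* (con true :* con true) := con false) refl)
      ; 3F → trans (*-cong refl (*-cong refl refl)) (solve 0 (con true :* (con true :* con true) := con true) refl) } }

  -- `P₀` is the only point of 𝒞 on `ℓ₀`, so χ fixes it. Points of `ℓ₀` satisfy x₁ = 0 and x₀ = x₂;
  -- for the image of (1, 0, 1, 0) this reads η²γ = 0 and η³ = ηγ² + η, hence γ = 0 and (η + 1)² =
  -- 0.
  stabilizer-ℓ₀ : 7 ℕ.≤ q → ∀ χ → InG χ → ℓ₀ ▹ᴸ χ ≈ᴸ ℓ₀ → χ ≈ᴳ identity
  stabilizer-ℓ₀ 7≤q χ χ∈G ℓ₀χ≈ℓ₀ =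
    let (X , _ , _ , unique) , _ = ℓ₀-IsUnΓ
        P₀χ∈ℓ₀ = Equivalence.to (ℓ₀χ≈ℓ₀ (P₀ ▹ χ)) (A∈ (ℓ₀ ▹ᴸ χ))
        P₀χ∼P₀ = ∼-trans (P₀ ▹ χ) X P₀ (unique (P₀ ▹ χ) (Equivalence.to (χ∈G P₀) P₀∈C) P₀χ∈ℓ₀)
                   (∼-sym P₀ X (unique P₀ P₀∈C (A∈ ℓ₀)))
        e , η , γ , e≉0 , η≉0 , χ≈ = stabilizer-P₀ 7≤q χ χ∈G P₀χ∼P₀
        x≈ , y≈ , z≈ = image-P₁₀₁₀ χ e η γ χ≈
        u , v , Q≈   = Equivalence.to (ℓ₀χ≈ℓ₀ (P₁₀₁₀ ▹ χ)) (B∈ (ℓ₀ ▹ᴸ χ))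
        γ≈0 : γ ≈ 0#
        γ≈0 = *-integral η≉0 (*-integral η≉0 (*-integral e≉0 (trans (sym y≈) (trans (Q≈ 1F) (u ⊡ refl ⊞ v ⊡ refl)))))
        η+1≈0 : η + 1# ≈ 0#
        η+1≈0 = square≈0 (*-integral η≉0 (*-integral e≉0 (trans
          (solve 4 (λ e η γ x → e :* (η :* ((η :+ con true) :* (η :+ con true)))
              := (x :+ e :* (η :* (η :* η))) :+ (x :+ e :* (η :* (γ :* γ) :+ η)) :+ (e :* η :* γ) :* γ)
            refl e η γ (coord (P₁₀₁₀ ▹ χ) 0F))
          (≈⇒+≈0 x≈ ⊞ ≈⇒+≈0 (trans (Q≈ 0F) (trans (sym (Q≈ 2F)) z≈)) ⊞ (e * η * γ) ⊡ γ≈0))))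
    in e , e≉0 , λ i j → trans (χ≈ i j) (*-congˡ (cubeMatrix-identity (+≈0⇒≈ η+1≈0) γ≈0 i j))

  δ-·ᴹ : ∀ M i j → (δ i ·ᴹ M) j ≈ M i j
  δ-·ᴹ M i j = row i
    where
    x = λ k → M k j
    rowᴱ′ : Fin 4 → (x₀ x₁ x₂ x₃ : Polynomial 4) → _
    rowᴱ′ i x₀ x₁ x₂ x₃ = sumᴱ (λ k → δᴱ i k :* rowᴱ x₀ x₁ x₂ x₃ k) := rowᴱ x₀ x₁ x₂ x₃ i

    row : ∀ i → (δ i ·ᴹ M) j ≈ M i j
    row 0F = solve 4 (rowᴱ′ 0F) refl (x 0F) (x 1F) (x 2F) (x 3F)
    row 1F = solve 4 (rowᴱ′ 1F) refl (x 0F) (x 1F) (x 2F) (x 3F)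
    row 2F = solve 4 (rowᴱ′ 2F) refl (x 0F) (x 1F) (x 2F) (x 3F)
    row 3F = solve 4 (rowᴱ′ 3F) refl (x 0F) (x 1F) (x 2F) (x 3F)

  -- Scalar matrices are central: ψφψ⁻¹ = k gives φ = ψ⁻¹kψ = k, computed row by row.
  conjugate-identity : ∀ ψ φ → ψ ⨾ φ ⨾ invert ψ ≈ᴳ identity → φ ≈ᴳ identity
  conjugate-identity ψ φ (k , k≉0 , χ≈) = k , k≉0 , λ i j → begin
    mat φ i j                                    ≈⟨ δ-·ᴹ (mat φ) i j ⟨
    (δ i ·ᴹ mat φ) j                             ≈⟨ ·ᴹ-cong (mat φ) (Projectivity.inverseˡ ψ i) j ⟨
    ((N⁻¹ i ·ᴹ N) ·ᴹ mat φ) j                    ≈⟨ ·ᴹ-cancel (invert ψ) ((N⁻¹ i ·ᴹ N) ·ᴹ mat φ) j ⟨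
    ((((N⁻¹ i ·ᴹ N) ·ᴹ mat φ) ·ᴹ N⁻¹) ·ᴹ N) j    ≈⟨ ·ᴹ-cong N (scalar i) j ⟩
    ((λ l → k * N⁻¹ i l) ·ᴹ N) j                 ≈⟨ ·ᴹ-scale k (N⁻¹ i) N j ⟩
    k * (N⁻¹ i ·ᴹ N) j                           ≈⟨ *-congˡ (Projectivity.inverseˡ ψ i j) ⟩
    k * δ i j                                    ∎
    where
    N = mat ψ
    N⁻¹ = mat (invert ψ)

    scalar : ∀ i j → (((N⁻¹ i ·ᴹ N) ·ᴹ mat φ) ·ᴹ N⁻¹) j ≈ k * N⁻¹ i j
    scalar i j = begin
      (((N⁻¹ i ·ᴹ N) ·ᴹ mat φ) ·ᴹ N⁻¹) j                 ≈⟨ ·ᴹ-cong N⁻¹ (·ᴹ-assoc (N⁻¹ i) N (mat φ)) j ⟩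
      ((N⁻¹ i ·ᴹ (N *ᴹ mat φ)) ·ᴹ N⁻¹) j                 ≈⟨ ·ᴹ-assoc (N⁻¹ i) (N *ᴹ mat φ) N⁻¹ j ⟩
      (N⁻¹ i ·ᴹ mat (ψ ⨾ φ ⨾ invert ψ)) j                ≈⟨ sum-cong-≋ (λ l → *-congˡ {N⁻¹ i l} (χ≈ l j)) ⟩
      sum (λ l → N⁻¹ i l * (k * δ l j))                  ≈⟨ sum-cong-≋ (λ l → x∙yz≈yx∙z (N⁻¹ i l) k (δ l j)) ⟩
      sum (λ l → k * N⁻¹ i l * δ l j)                    ≈⟨ sum-δ (λ l → k * N⁻¹ i l) j ⟩
      k * N⁻¹ i j                                        ∎

  -- Projectivities act on the right, so if m = ℓ₀ψ is fixed by φ, then ℓ₀ is fixed by ψφψ⁻¹.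
  stabilizer-trivial : 7 ℕ.≤ q → ∀ m → IsUnΓ m → ∀ φ → InG φ → m ▹ᴸ φ ≈ᴸ m → φ ≈ᴳ identity
  stabilizer-trivial 7≤q m m-IsUnΓ φ φ∈G mφ≈m =
    let ψ , ψ∈G , m≈ = IsUnΓ⇒image m m-IsUnΓ
        ψ⁻¹ = invert ψ
        ℓ   = ℓ₀ ▹ᴸ ψ
        ℓφ≈ℓ : ℓ ▹ᴸ φ ≈ᴸ ℓ
        ℓφ≈ℓ = ≈ᴸ-trans {ℓ ▹ᴸ φ} {m ▹ᴸ φ} {ℓ}
          (≈ᴸ-▹ ℓ m φ (≈ᴸ-sym {m} {ℓ} m≈))
          (≈ᴸ-trans {m ▹ᴸ φ} {m} {ℓ} mφ≈m m≈)
        ψφ  = ψ ⨾ φ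
        stable : ℓ₀ ▹ᴸ (ψφ ⨾ ψ⁻¹) ≈ᴸ ℓ₀
        stable = ≈ᴸ-trans {ℓ₀ ▹ᴸ (ψφ ⨾ ψ⁻¹)} {ℓ₀ ▹ᴸ ψφ ▹ᴸ ψ⁻¹} {ℓ₀}
          (≈ᴸ-sym {ℓ₀ ▹ᴸ ψφ ▹ᴸ ψ⁻¹} {ℓ₀ ▹ᴸ (ψφ ⨾ ψ⁻¹)} (▹ᴸ-⨾ ψφ ψ⁻¹ ℓ₀))
          (≈ᴸ-trans {ℓ₀ ▹ᴸ ψφ ▹ᴸ ψ⁻¹} {ℓ ▹ᴸ ψ⁻¹} {ℓ₀}
            (≈ᴸ-▹ (ℓ₀ ▹ᴸ ψφ) ℓ ψ⁻¹ (≈ᴸ-trans {ℓ₀ ▹ᴸ ψφ} {ℓ ▹ᴸ φ} {ℓ}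
              (≈ᴸ-sym {ℓ ▹ᴸ φ} {ℓ₀ ▹ᴸ ψφ} (▹ᴸ-⨾ ψ φ ℓ₀)) ℓφ≈ℓ))
            (▹ᴸ-invert ψ ℓ₀))
    in conjugate-identity ψ φ (stabilizer-ℓ₀ 7≤q (ψφ ⨾ ψ⁻¹)
         (InG-⨾ ψφ ψ⁻¹ (InG-⨾ ψ φ ψ∈G φ∈G) (InG-invert ψ ψ∈G)) stable)

theorem6p5 : ∀ {c ℓ} (q : ℕ) → q ≥ 8 → 2 ∣ q → (F : FiniteField c ℓ q) →
    let open PG3 F in
    (∀ m → IsUnΓ m ⇔ (∃[ φ ] (InG φ × m ≈ᴸ ℓ₀ ▹ᴸ φ)))
    × (∀ m → IsUnΓ m → ∀ φ → InG φ → m ▹ᴸ φ ≈ᴸ m → φ ≈ᴳ identity)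
theorem6p5 q q≥8 2∣q F =
  (λ m → mk⇔ (IsUnΓ⇒image m) λ (φ , φ∈G , m≈) →
    IsUnΓ-resp-≈ᴸ (ℓ₀ ▹ᴸ φ) m (≈ᴸ-sym {m} {ℓ₀ ▹ᴸ φ} m≈) (image-IsUnΓ 7≤q φ φ∈G)) ,
  stabilizer-trivial 7≤q
  where
  open PG3 F
  open Geometry F (FieldProperties.even⇒1+1≈0 F 2∣q)

  7≤q : 7 ℕ.≤ q
  7≤q = ℕ.≤-trans (ℕ.n≤1+n 7) q≥8
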